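{- Let $\lambda=(a,a)$ be a partition of $n=2a\ge3$. Suppose that $\Gamma,\Gamma'$ are two (reduced) nb-admissible $\overline{\mathcal S_n}$-graphs such that $U(\Gamma)\simeq U(\Gamma')\simeq\overline{\mathcal D}_\lambda$. If $\Gamma$ is disconnected, then there exists an embedding from $\Gamma$ to $\Gamma'$.
   Context: **Conventions.** For $k\in\mathbb Z$, $\overline{k}$ is the unique element of $\{1,\dots,n\}$ congruent to $k$ modulo $n$; $[1,n]=\{1,\dots,n\}$. $\overline{\mathcal S_n}$ is the affine symmetric group, a Coxeter group with simple reflections $s_0=s_n,s_1,\dots,s_{n-1}$ (type $\widetilde A_{n-1}$), identified with $[1,n]$ via $s_i\leftrightarrow i$. **Tableaux.** $\mathrm{RSYT}(\lambda)$ is the set of fillings of the Young diagram of $\lambda$ (English convention) by $1,\dots,n$, each used once, with rows increasing. $\overline{\mathrm{des}}(T)=\{i\in[1,n]\mid i\text{ lies in a strictly higher row of }T\text{ than }\overline{i+1}\}$. $T,T'\in\mathrm{RSYT}(\lambda)$ are connected by a Knuth move if $\overline{\mathrm{des}}(T),\overline{\mathrm{des}}(T')$ are incomparable under inclusion and $T'$ is obtained from $T$ by interchanging $\overline i$ and $\overline{i+1}$ for some $i$ (then re-sorting rows). **Labeled graphs and $W$-graphs.** For a Coxeter group $W$ with simple reflections $I$, an $I$-labeled graph $(V,m,\tau)$ consists of a set $V$, maps $m:V\times V\to\mathbb Z[q^{\pm1/2}]$ (written $m(u\triangleright v)$) and $\tau:V\to\{\text{subsets of }I\}$, such that for each $v$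 only finitely many $w$ have $m(v\triangleright w)\ne0$ or $m(w\triangleright v)\neq0$. There is an edge $u\to v$ iff $m(u\triangleright v)\ne0$; "disconnected" means that the underlying undirected graph is not connected. The graph is reduced if $m(u\triangleright v)=0$ whenever $\tau(u)\subset\tau(v)$. It is nb-admissible if all $m(u\triangleright v)\in\mathbb N=\{0,1,2,\dots\}$ and $m(u\triangleright v)=m(v\triangleright u)$ whenever $\tau(u),\tau(v)$ are incomparable. Let $\mathcal H_W$ be the Iwahori–Hecke algebra over $\mathbb Z[q^{\pm1/2}]$ with generators $T_i$ ($i\in I$) satisfying the braid relations and $(T_i-q)(T_i+1)=0$. The graph is a $W$-graph if the formulas $T_i(u)=qu$ if $i\notin\tau(u)$, and $T_i(u)=-u+q^{1/2}\sum_{v:\,i\notin\tau(v)}m(u\triangleright v)\,v$ if $i\in\tau(u)$, define an $\mathcal H_W$-module structure on $\bigoplus_{v\in V}\mathbb Z[q^{\pm1/2}]v$. The simple underlying graph $U(\Gamma)$ has the same $V,\tau$, and weight $m'$ with $m'(u\triangleright v)=m'(v\triangleright u)=1$ if $m(u\triangleright v)=m(v\triangleright u)=1$, and $m'(u\triangleright v)=m'(v\triangleright u)=0$ otherwise. Isomorphisms are bijections of vertices preserving $m$ and $\tau$. A subgraph of $(V',m',\tau')$ is $(V'',m'',\tau'')$ with $V''\subset V'$, $\tau''=\tau'|_{V''}$ and $m''(u\triangleright v)\in\{m'(u\triangleright v),0\}$; an embedding $\Gamma\to\Gamma'$ is an isomorphism of $\Gamma$ onto a subgraph of $\Gamma'$.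 **The graph $\overline{\mathcal D}_\lambda$.** The $[1,n]$-labeled graph with vertex set $\mathrm{RSYT}(\lambda)$, $\tau=\overline{\mathrm{des}}$, and $m(u\triangleright v)=m(v\triangleright u)=1$ if $u,v$ are connected by a Knuth move, $0$ otherwise. -}

module Defs where

open import Algebra.Bundles using (CommutativeRing; Ring)
open import Algebra.Module.Structures using (IsLeftModule)
open import Algebra.Structures using (IsAbelianGroup; IsCommutativeRing)
open import Data.Bool.Base using (true; false; if_then_else_; _∧_; _∨_)
open import Data.Fin.Base using (Fin; toℕ; _<_)
import Data.Fin.Permutation as Perm
import Data.Fin.Properties as Fin
open import Data.Fin.Subset using (Subset; _⊆_)
open import Data.Fin.Subset.Properties using (_⊆?_) renaming (_∈?_ to _∈ₛ?_)
open import Data.Integer.Base as ℤ using (ℤ; +_; 0ℤ; 1ℤ)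
import Data.Integer.Properties as ℤ
open import Data.Integer.Tactic.RingSolver using (solve-∀)
open import Data.List.Base using (List; []; _∷_; _++_; map; concat; filter; cartesianProductWith; deduplicate; allFin; length)
open import Data.List.Membership.Propositional using (_∈_)
import Data.List.Membership.Propositional.Properties as Mem
import Data.List.Properties as List
open import Data.List.Relation.Binary.Permutation.Propositional using (_↭_; ↭-refl; ↭-reflexive; ↭-sym; ↭-trans; ↭⇒↭ₛ)
import Data.List.Relation.Binary.Permutation.Propositional.Properties as ↭
import Data.List.Relation.Binary.Permutation.Setoid.Properties as ↭ₛ
import Data.List.Relation.Binary.Pointwise as Pointwise
open import Data.List.Relation.Unary.All as All using (All; []; _∷_)
import Data.List.Relation.Unary.All.Properties as All
open import Data.List.Relation.Unary.AllPairs using ([]; _∷_)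
open import Data.List.Relation.Unary.Any using (here; there)
open import Data.List.Relation.Unary.Linked as Linked using (Linked; []; [-]; _∷_)
import Data.List.Relation.Unary.Sorted.TotalOrder.Properties as Sorted
open import Data.List.Relation.Unary.Unique.Propositional using (Unique)
import Data.List.Relation.Unary.Unique.Propositional.Properties as Unique
import Data.List.Relation.Unary.Unique.DecPropositional.Properties as DecUnique
import Data.List.Sort.InsertionSort as InsertionSort
import Data.List.Sort.InsertionSort.Properties as InsertionSortₚ
open import Data.Nat.Base as ℕ using (ℕ; zero; suc)
open import Data.Nat.DivMod using (_mod_)
open import Data.Nat.ListAction using (sum)
import Data.Nat.Properties as ℕ
open import Data.Product.Base using (Σ; ∃-syntax; _×_; _,_; proj₁; proj₂)
open import Data.Sum.Base using (_⊎_; inj₁; inj₂)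
open import Data.Vec.Base using (tabulate)
open import Function.Base using (_∘_)
open import Function.Bundles using (_↔_; module Inverse)
open import Function.Definitions using (Injective)
open import Level using (_⊔_; 0ℓ)
open import Relation.Binary.Construct.Closure.Equivalence using (EqClosure)
open import Relation.Binary.Definitions using (DecidableEquality)
open import Relation.Binary.PropositionalEquality using (_≡_; refl; sym; trans; cong; cong₂; subst; setoid)
open import Relation.Binary.Structures using (IsEquivalence)
open import Relation.Nullary using (¬_; Dec; yes; no; does; contradiction)
open import Relation.Nullary.Decidable using (_×-dec_; ¬?; map′; recompute; dec-true; dec-false)

-- A list (r₁ , b₁) ∷ (r₂ , b₂) ∷ … stands for r₁b₁ + r₂b₂ + … in the free
-- R-module on B; a basis element may occur repeatedly, and two lists are
-- identified when all their coefficients agree.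
module FormalSums {c ℓ b} (R : CommutativeRing c ℓ) {B : Set b} (_≟_ : DecidableEquality B) where

  open CommutativeRing R renaming (Carrier to A)

  FormalSum : Set (c ⊔ b)
  FormalSum = List (A × B)

  coeff : FormalSum → B → A
  coeff []            x = 0#
  coeff ((r , y) ∷ f) x = (if does (y ≟ x) then r else 0#) + coeff f x

  infix 4 _≋_
  record _≋_ (f g : FormalSum) : Set (b ⊔ ℓ) where
    constructor mk≋
    field coeff-≈ : ∀ x → coeff f x ≈ coeff g x
  open _≋_ public

  basis : B → FormalSum
  basis x = (1# , x) ∷ []

  infixr 7 _·_
  _·_ : A → FormalSum → FormalSum
  r · f = map (λ (s , x) → r * s , x) f

  negate : FormalSum → FormalSum
  negate = map (λ (s , x) → - s , x)

-- The pair (c , e) is the monomial c·q^{e/2}.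
open FormalSums ℤ.+-*-commutativeRing ℤ._≟_ using () renaming
  ( FormalSum to Laurent; coeff to coeffᴸ; _≋_ to _≈ᴸ_; mk≋ to mk≈ᴸ; coeff-≈ to coeffᴸ-≡
  ; negate to -ᴸ_ ) public

infix 4 _≈ᴸ?_
infixl 6 _+ᴸ_
infixl 7 _*ᴸ_

_+ᴸ_ : Laurent → Laurent → Laurent
_+ᴸ_ = _++_

mulMonomial : ℤ × ℤ → ℤ × ℤ → ℤ × ℤ
mulMonomial (c , e) (d , k) = c ℤ.* d , e ℤ.+ k

_*ᴸ_ : Laurent → Laurent → Laurent
_*ᴸ_ = cartesianProductWith mulMonomial

0ᴸ 1ᴸ q q½ : Laurent
0ᴸ = []
1ᴸ = (1ℤ , + 0) ∷ []
q  = (1ℤ , + 2) ∷ []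
q½ = (1ℤ , + 1) ∷ []

fromℕᴸ : ℕ → Laurent
fromℕᴸ k = (+ k , + 0) ∷ []

module LaurentProperties where

  isEquivalence : IsEquivalence _≈ᴸ_
  isEquivalence = record
    { refl  = mk≈ᴸ λ _ → refl
    ; sym   = λ p → mk≈ᴸ λ x → sym (coeffᴸ-≡ p x)
    ; trans = λ p r → mk≈ᴸ λ x → trans (coeffᴸ-≡ p x) (coeffᴸ-≡ r x)
    }

  open IsEquivalence isEquivalence public
    using () renaming (refl to ≈-refl; sym to ≈-sym; trans to ≈-trans; reflexive to ≈-reflexive)

  coeff-++ : ∀ f g k → coeffᴸ (f ++ g) k ≡ coeffᴸ f k ℤ.+ coeffᴸ g k
  coeff-++ []            g k = sym (ℤ.+-identityˡ _)
  coeff-++ ((c , e) ∷ f) g k =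
    trans (cong (ℤ._+_ c′) (coeff-++ f g k)) (sym (ℤ.+-assoc c′ (coeffᴸ f k) (coeffᴸ g k)))
    where c′ = if does (e ℤ.≟ k) then c else 0ℤ

  coeff-neg : ∀ f k → coeffᴸ (-ᴸ f) k ≡ ℤ.- coeffᴸ f k
  coeff-neg []            k = refl
  coeff-neg ((c , e) ∷ f) k with does (e ℤ.≟ k)
  ... | true  = trans (cong (ℤ._+_ (ℤ.- c)) (coeff-neg f k)) (sym (ℤ.neg-distrib-+ c (coeffᴸ f k)))
  ... | false = trans (cong (ℤ._+_ 0ℤ) (coeff-neg f k)) (sym (ℤ.neg-distrib-+ 0ℤ (coeffᴸ f k)))

  +-cong : ∀ {f f′ g g′} → f ≈ᴸ f′ → g ≈ᴸ g′ → f +ᴸ g ≈ᴸ f′ +ᴸ g′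
  +-cong {f} {f′} {g} {g′} p r = mk≈ᴸ λ k → trans (coeff-++ f g k)
    (trans (cong₂ ℤ._+_ (coeffᴸ-≡ p k) (coeffᴸ-≡ r k)) (sym (coeff-++ f′ g′ k)))

  +-comm : ∀ f g → f +ᴸ g ≈ᴸ g +ᴸ f
  +-comm f g = mk≈ᴸ λ k → trans (coeff-++ f g k)
    (trans (ℤ.+-comm (coeffᴸ f k) _) (sym (coeff-++ g f k)))

  +-inverseˡ : ∀ f → (-ᴸ f) +ᴸ f ≈ᴸ 0ᴸ
  +-inverseˡ f = mk≈ᴸ λ k → trans (coeff-++ (-ᴸ f) f k)
    (trans (cong (ℤ._+ coeffᴸ f k) (coeff-neg f k)) (ℤ.+-inverseˡ (coeffᴸ f k)))

  +-isAbelianGroup : IsAbelianGroup _≈ᴸ_ _+ᴸ_ 0ᴸ -ᴸ_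
  +-isAbelianGroup = record
    { isGroup = record
      { isMonoid = record
        { isSemigroup = record
          { isMagma = record { isEquivalence = isEquivalence ; ∙-cong = +-cong }
          ; assoc = λ f g h → ≈-reflexive (List.++-assoc f g h)
          }
        ; identity = (λ _ → ≈-refl) , (λ f → ≈-reflexive (List.++-identityʳ f))
        }
      ; inverse = +-inverseˡ , (λ f → ≈-trans (+-comm f (-ᴸ f)) (+-inverseˡ f))
      ; ⁻¹-cong = λ {f} {g} p → mk≈ᴸ λ k →
          trans (coeff-neg f k) (trans (cong ℤ.-_ (coeffᴸ-≡ p k)) (sym (coeff-neg g k)))
      }
    ; comm = +-comm
    }

  shift-iff : ∀ e d k → does (e ℤ.+ d ℤ.≟ k) ≡ does (d ℤ.≟ k ℤ.- e)
  shift-iff e d k with d ℤ.≟ k ℤ.- e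
  ... | yes refl = dec-true (e ℤ.+ (k ℤ.- e) ℤ.≟ k) (lemma e k)
    where lemma : ∀ e k → e ℤ.+ (k ℤ.- e) ≡ k
          lemma = solve-∀
  ... | no  d≢   = dec-false (e ℤ.+ d ℤ.≟ k) λ { refl → d≢ (lemma e d) }
    where lemma : ∀ e d → d ≡ e ℤ.+ d ℤ.- e
          lemma = solve-∀

  coeff-monomial-* : ∀ c e g k →
    coeffᴸ (map (mulMonomial (c , e)) g) k ≡ c ℤ.* coeffᴸ g (k ℤ.- e)
  coeff-monomial-* c e []            k = sym (ℤ.*-zeroʳ c)
  coeff-monomial-* c e ((d , j) ∷ g) k
    rewrite shift-iff e j k | coeff-monomial-* c e g k
    with does (j ℤ.≟ k ℤ.- e)
  ... | true  = sym (ℤ.*-distribˡ-+ c d _)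
  ... | false = trans (cong (ℤ._+ (c ℤ.* coeffᴸ g (k ℤ.- e))) (sym (ℤ.*-zeroʳ c)))
                      (sym (ℤ.*-distribˡ-+ c 0ℤ _))

  *-congˡ : ∀ f {g g′} → g ≈ᴸ g′ → f *ᴸ g ≈ᴸ f *ᴸ g′
  *-congˡ []            p = ≈-refl
  *-congˡ ((c , e) ∷ f) {g} {g′} p = +-cong
    (mk≈ᴸ λ k → trans (coeff-monomial-* c e g k)
      (trans (cong (c ℤ.*_) (coeffᴸ-≡ p _)) (sym (coeff-monomial-* c e g′ k))))
    (*-congˡ f p)

  *-zeroʳ : ∀ f → f *ᴸ 0ᴸ ≡ 0ᴸ
  *-zeroʳ []      = refl
  *-zeroʳ (_ ∷ f) = *-zeroʳ f

  mulMonomial-comm : ∀ x y → mulMonomial x y ≡ mulMonomial y x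
  mulMonomial-comm (c , e) (d , k) = cong₂ _,_ (ℤ.*-comm c d) (ℤ.+-comm e k)

  mulMonomial-assoc : ∀ x y z → mulMonomial (mulMonomial x y) z ≡ mulMonomial x (mulMonomial y z)
  mulMonomial-assoc (c , e) (d , k) (b , j) = cong₂ _,_ (ℤ.*-assoc c d b) (ℤ.+-assoc e k j)

  *-∷ʳ : ∀ f x g → f *ᴸ (x ∷ g) ≈ᴸ map (mulMonomial x) f +ᴸ f *ᴸ g
  *-∷ʳ []      x g = ≈-refl
  *-∷ʳ (y ∷ f) x g = +-cong {y *₁ x} {x *₁ y} (≈-reflexive (cong (_∷ []) (mulMonomial-comm y x)))
    (≈-trans (+-cong {map (mulMonomial y) g} ≈-refl (*-∷ʳ f x g))
    (≈-trans (≈-reflexive (sym (List.++-assoc (map (mulMonomial y) g) xf _)))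
    (≈-trans (+-cong (+-comm (map (mulMonomial y) g) xf) ≈-refl)
             (≈-reflexive (List.++-assoc xf (map (mulMonomial y) g) _)))))
    where
    xf = map (mulMonomial x) f
    _*₁_ : ℤ × ℤ → ℤ × ℤ → Laurent
    u *₁ v = mulMonomial u v ∷ []

  *-comm : ∀ f g → f *ᴸ g ≈ᴸ g *ᴸ f
  *-comm []      g = ≈-reflexive (sym (*-zeroʳ g))
  *-comm (x ∷ f) g = ≈-trans
    (+-cong {map (mulMonomial x) g} ≈-refl (*-comm f g)) (≈-sym (*-∷ʳ g x f))

  *-cong : ∀ {f f′ g g′} → f ≈ᴸ f′ → g ≈ᴸ g′ → f *ᴸ g ≈ᴸ f′ *ᴸ g′
  *-cong {f} {f′} {g} {g′} p r = ≈-trans (*-congˡ f r)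
    (≈-trans (*-comm f g′) (≈-trans (*-congˡ g′ p) (*-comm g′ f′)))

  *-distribʳ : ∀ h f g → (f +ᴸ g) *ᴸ h ≡ f *ᴸ h +ᴸ g *ᴸ h
  *-distribʳ h []      g = refl
  *-distribʳ h (x ∷ f) g = trans (cong (map (mulMonomial x) h ++_) (*-distribʳ h f g))
    (sym (List.++-assoc (map (mulMonomial x) h) _ _))

  *-distribˡ : ∀ h f g → h *ᴸ (f +ᴸ g) ≈ᴸ h *ᴸ f +ᴸ h *ᴸ g
  *-distribˡ h f g = ≈-trans (*-comm h (f +ᴸ g)) (≈-trans (≈-reflexive (*-distribʳ h f g))
    (+-cong (*-comm f h) (*-comm g h)))

  monomial-*-assoc : ∀ x g h → map (mulMonomial x) g *ᴸ h ≡ map (mulMonomial x) (g *ᴸ h)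
  monomial-*-assoc x []      h = refl
  monomial-*-assoc x (y ∷ g) h = trans
    (cong₂ _++_ (trans (List.map-cong (mulMonomial-assoc x y) h) (List.map-∘ h))
                (monomial-*-assoc x g h))
    (sym (List.map-++ (mulMonomial x) (map (mulMonomial y) h) (g *ᴸ h)))

  *-assoc : ∀ f g h → (f *ᴸ g) *ᴸ h ≡ f *ᴸ (g *ᴸ h)
  *-assoc []      g h = refl
  *-assoc (x ∷ f) g h = trans (*-distribʳ h (map (mulMonomial x) g) (f *ᴸ g))
    (cong₂ _++_ (monomial-*-assoc x g h) (*-assoc f g h))

  *-identityˡ : ∀ f → 1ᴸ *ᴸ f ≡ f
  *-identityˡ f = trans (List.++-identityʳ _) (trans
    (List.map-cong (λ (c , e) → cong₂ _,_ (ℤ.*-identityˡ c) (ℤ.+-identityˡ e)) f) (List.map-id f))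

  isCommutativeRing : IsCommutativeRing _≈ᴸ_ _+ᴸ_ _*ᴸ_ -ᴸ_ 0ᴸ 1ᴸ
  isCommutativeRing = record
    { isRing = record
      { +-isAbelianGroup = +-isAbelianGroup
      ; *-cong = *-cong
      ; *-assoc = λ f g h → ≈-reflexive (*-assoc f g h)
      ; *-identity = (λ f → ≈-reflexive (*-identityˡ f))
                   , (λ f → ≈-trans (*-comm f 1ᴸ) (≈-reflexive (*-identityˡ f)))
      ; distrib = *-distribˡ , (λ h f g → ≈-reflexive (*-distribʳ h f g))
      }
    ; *-comm = *-comm
    }

  1≉0 : ¬ 1ᴸ ≈ᴸ 0ᴸ
  1≉0 p with coeffᴸ-≡ p (+ 0)
  ... | ()

  exponents : Laurent → List ℤ
  exponents = map proj₂

  coeff-outside : ∀ f k → ¬ k ∈ exponents f → coeffᴸ f k ≡ 0ℤ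
  coeff-outside []            k k∉ = refl
  coeff-outside ((c , e) ∷ f) k k∉
    rewrite dec-false (e ℤ.≟ k) (λ { refl → k∉ (here refl) }) =
      trans (ℤ.+-identityˡ _) (coeff-outside f k (k∉ ∘ there))

laurentRing : CommutativeRing 0ℓ 0ℓ
laurentRing = record { isCommutativeRing = LaurentProperties.isCommutativeRing }

_≈ᴸ?_ : (f g : Laurent) → Dec (f ≈ᴸ g)
f ≈ᴸ? g = map′ agree (λ p → All.universal (coeffᴸ-≡ p) _)
  (All.all? (λ k → coeffᴸ f k ℤ.≟ coeffᴸ g k) (exponents f ++ exponents g))
  where
  open LaurentProperties
  open import Data.List.Membership.DecPropositional ℤ._≟_ using (_∈?_)
  agree : All (λ k → coeffᴸ f k ≡ coeffᴸ g k) (exponents f ++ exponents g) → f ≈ᴸ g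
  agree p = mk≈ᴸ λ k → case-∈ k (k ∈? (exponents f ++ exponents g))
    where
    case-∈ : ∀ k → Dec (k ∈ exponents f ++ exponents g) → coeffᴸ f k ≡ coeffᴸ g k
    case-∈ k (yes k∈) = All.lookup p k∈
    case-∈ k (no  k∉) = trans (coeff-outside f k (k∉ ∘ Mem.∈-++⁺ˡ))
      (sym (coeff-outside g k (k∉ ∘ Mem.∈-++⁺ʳ (exponents f))))

indicator : ∀ {p} {P : Set p} → Dec P → Laurent
indicator d = if does d then 1ᴸ else 0ᴸ

indicator≉0 : ∀ {p} {P : Set p} (d : Dec P) → ¬ indicator d ≈ᴸ 0ᴸ → P
indicator≉0 (yes p) _ = p
indicator≉0 (no  _) h = contradiction LaurentProperties.≈-refl h

-- The element i of {1,…,n} is represented by the element of Fin n with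
-- toℕ-value i - 1; the order on Fin n is then the usual order on {1,…,n},
-- and next i is the representative of i + 1 modulo n.
next : ∀ {n} → Fin n → Fin n
next {suc n} i = suc (toℕ i) mod suc n

-- The value 0 stands for ∞: the corresponding braid relation below is 1 = 1.
CoxeterMatrix : ℕ → Set
CoxeterMatrix n = Fin n → Fin n → ℕ

-- The Coxeter matrix of type Ã_{n-1}; only meant for n ≥ 3.
affineS : ∀ n → CoxeterMatrix n
affineS n i j =
  if does (i Fin.≟ j) then 1 else
  if does (j Fin.≟ next i) ∨ does (i Fin.≟ next j) then 3 else 2

module Hecke {n} (M : CoxeterMatrix n) where

  infixl 6 _⊕_
  infixl 7 _⊗_
  infix  8 ⊝_
  infix  4 _≈ᴴ_

  data H : Set where
    scalar  : Laurent → H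
    T       : Fin n → H
    _⊕_ _⊗_ : H → H → H
    ⊝_      : H → H

  0ᴴ 1ᴴ : H
  0ᴴ = scalar 0ᴸ
  1ᴴ = scalar 1ᴸ

  -- alternating k i j = TᵢTⱼTᵢ⋯ with k factors.
  alternating : ℕ → Fin n → Fin n → H
  alternating zero    i j = 1ᴴ
  alternating (suc k) i j = T i ⊗ alternating k j i

  data _≈ᴴ_ : H → H → Set where
    ≈-refl       : ∀ {x} → x ≈ᴴ x
    ≈-sym        : ∀ {x y} → x ≈ᴴ y → y ≈ᴴ x
    ≈-trans      : ∀ {x y z} → x ≈ᴴ y → y ≈ᴴ z → x ≈ᴴ z
    ⊕-cong       : ∀ {x x′ y y′} → x ≈ᴴ x′ → y ≈ᴴ y′ → x ⊕ y ≈ᴴ x′ ⊕ y′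
    ⊗-cong       : ∀ {x x′ y y′} → x ≈ᴴ x′ → y ≈ᴴ y′ → x ⊗ y ≈ᴴ x′ ⊗ y′
    ⊝-cong       : ∀ {x x′} → x ≈ᴴ x′ → ⊝ x ≈ᴴ ⊝ x′
    ⊕-assoc      : ∀ x y z → (x ⊕ y) ⊕ z ≈ᴴ x ⊕ (y ⊕ z)
    ⊕-comm       : ∀ x y → x ⊕ y ≈ᴴ y ⊕ x
    ⊕-identityˡ  : ∀ x → 0ᴴ ⊕ x ≈ᴴ x
    ⊕-inverseˡ   : ∀ x → ⊝ x ⊕ x ≈ᴴ 0ᴴ
    ⊗-assoc      : ∀ x y z → (x ⊗ y) ⊗ z ≈ᴴ x ⊗ (y ⊗ z)
    ⊗-identityˡ  : ∀ x → 1ᴴ ⊗ x ≈ᴴ x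
    ⊗-identityʳ  : ∀ x → x ⊗ 1ᴴ ≈ᴴ x
    distribˡ     : ∀ x y z → x ⊗ (y ⊕ z) ≈ᴴ x ⊗ y ⊕ x ⊗ z
    distribʳ     : ∀ x y z → (y ⊕ z) ⊗ x ≈ᴴ y ⊗ x ⊕ z ⊗ x
    scalar-cong  : ∀ {r s} → r ≈ᴸ s → scalar r ≈ᴴ scalar s
    scalar-+     : ∀ r s → scalar (r +ᴸ s) ≈ᴴ scalar r ⊕ scalar s
    scalar-*     : ∀ r s → scalar (r *ᴸ s) ≈ᴴ scalar r ⊗ scalar s
    scalar-comm  : ∀ r x → scalar r ⊗ x ≈ᴴ x ⊗ scalar r
    braid        : ∀ i j → alternating (M i j) i j ≈ᴴ alternating (M i j) j i
    quadratic    : ∀ i → (T i ⊕ ⊝ scalar q) ⊗ (T i ⊕ 1ᴴ) ≈ᴴ 0ᴴ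

  heckeRing : Ring 0ℓ 0ℓ
  heckeRing = record
    { Carrier = H
    ; _≈_ = _≈ᴴ_
    ; _+_ = _⊕_
    ; _*_ = _⊗_
    ; -_ = ⊝_
    ; 0# = 0ᴴ
    ; 1# = 1ᴴ
    ; isRing = record
      { +-isAbelianGroup = record
        { isGroup = record
          { isMonoid = record
            { isSemigroup = record
              { isMagma = record
                { isEquivalence = record { refl = ≈-refl ; sym = ≈-sym ; trans = ≈-trans }
                ; ∙-cong = ⊕-cong
                }
              ; assoc = ⊕-assoc
              }
            ; identity = ⊕-identityˡ , λ x → ≈-trans (⊕-comm x 0ᴴ) (⊕-identityˡ x)
            }
          ; inverse = ⊕-inverseˡ , λ x → ≈-trans (⊕-comm x (⊝ x)) (⊕-inverseˡ x)
          ; ⁻¹-cong = ⊝-cong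
          }
        ; comm = ⊕-comm
        }
      ; *-cong = ⊗-cong
      ; *-assoc = ⊗-assoc
      ; *-identity = ⊗-identityˡ , ⊗-identityʳ
      ; distrib = distribˡ , distribʳ
      }
    }

record LabeledGraph (n : ℕ) : Set₁ where
  field
    V   : Set
    _≟_ : DecidableEquality V
    m   : V → V → Laurent
    τ   : V → Subset n
    -- Local finiteness; nbrs v may also list vertices v is not joined to, which
    -- contribute 0 to the sum in T-formula.
    nbrs          : V → List V
    nbrs-unique   : ∀ v → Unique (nbrs v)
    nbrs-complete : ∀ v w → ¬ m v w ≈ᴸ 0ᴸ ⊎ ¬ m w v ≈ᴸ 0ᴸ → w ∈ nbrs v

  Edge : V → V → Set
  Edge u v = ¬ m u v ≈ᴸ 0ᴸ

  Connected : Set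
  Connected = ∀ u v → EqClosure Edge u v

  Disconnected : Set
  Disconnected = ¬ Connected

Incomparable : ∀ {n} → Subset n → Subset n → Set
Incomparable S S′ = ¬ S ⊆ S′ × ¬ S′ ⊆ S

Reduced : ∀ {n} → LabeledGraph n → Set
Reduced Γ = ∀ u v → τ u ⊆ τ v → m u v ≈ᴸ 0ᴸ
  where open LabeledGraph Γ

record NbAdmissible {n} (Γ : LabeledGraph n) : Set where
  open LabeledGraph Γ
  field
    natural   : ∀ u v → ∃[ k ] m u v ≈ᴸ fromℕᴸ k
    symmetric : ∀ u v → Incomparable (τ u) (τ v) → m u v ≈ᴸ m v u

record IsWGraph {n} (M : CoxeterMatrix n) (Γ : LabeledGraph n) : Set where
  open LabeledGraph Γ
  open FormalSums laurentRing _≟_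
  open Hecke M

  T-formula : Fin n → V → FormalSum
  T-formula i u =
    if does (i ∈ₛ? τ u)
      then negate (basis u) ++ q½ · map (λ v → m u v , v) (filter (λ v → ¬? (i ∈ₛ? τ v)) (nbrs u))
      else q · basis u

  field
    _*ₗ_         : H → FormalSum → FormalSum
    isLeftModule : IsLeftModule heckeRing _≋_ _++_ [] negate _*ₗ_
    scalar-*ₗ    : ∀ r f → scalar r *ₗ f ≋ r · f
    T-*ₗ         : ∀ i u → T i *ₗ basis u ≋ T-formula i u

record _≅_ {n} (Γ Δ : LabeledGraph n) : Set where
  private
    module Γ = LabeledGraph Γ
    module Δ = LabeledGraph Δ
  field
    bijection : Γ.V ↔ Δ.V
  open Inverse bijection public using (to; from)
  field
    m-pres : ∀ u v → Δ.m (to u) (to v) ≈ᴸ Γ.m u v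
    τ-pres : ∀ u → Δ.τ (to u) ≡ Γ.τ u

-- The vertex subset is presented as an injection.
record IsSubgraph {n} (Γ″ Γ′ : LabeledGraph n) : Set where
  private
    module Γ″ = LabeledGraph Γ″
    module Γ′ = LabeledGraph Γ′
  field
    incl     : Γ″.V → Γ′.V
    incl-inj : Injective _≡_ _≡_ incl
    m-sub    : ∀ u v → Γ″.m u v ≈ᴸ Γ′.m (incl u) (incl v) ⊎ Γ″.m u v ≈ᴸ 0ᴸ
    τ-sub    : ∀ u → Γ″.τ u ≡ Γ′.τ (incl u)

Embedding : ∀ {n} → LabeledGraph n → LabeledGraph n → Set₁
Embedding {n} Γ Γ′ = Σ (LabeledGraph n) λ Γ″ → IsSubgraph Γ″ Γ′ × Γ ≅ Γ″

simpleUnderlying : ∀ {n} → LabeledGraph n → LabeledGraph n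
simpleUnderlying Γ = record
  { V = V ; _≟_ = _≟_ ; m = m′ ; τ = τ
  ; nbrs = nbrs ; nbrs-unique = nbrs-unique
  ; nbrs-complete = λ v w → λ where
      (inj₁ p) → nbrs-complete v w (inj₁ (edge v w p))
      (inj₂ p) → nbrs-complete v w (inj₂ (edge w v p))
  }
  where
  open LabeledGraph Γ
  open LaurentProperties using (1≉0; ≈-sym; ≈-trans)
  bothOne? : ∀ u v → Dec (m u v ≈ᴸ 1ᴸ × m v u ≈ᴸ 1ᴸ)
  bothOne? u v = (m u v ≈ᴸ? 1ᴸ) ×-dec (m v u ≈ᴸ? 1ᴸ)
  m′ : V → V → Laurent
  m′ u v = indicator (bothOne? u v)
  edge : ∀ u v → ¬ m′ u v ≈ᴸ 0ᴸ → ¬ m u v ≈ᴸ 0ᴸ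
  edge u v p z = 1≉0 (≈-trans (≈-sym (proj₁ (indicator≉0 (bothOne? u v) p))) z)

-- The proofs are irrelevant, so tableaux with the same rows are equal.
record RSYT (μ : List ℕ) : Set where
  constructor mkRSYT
  field
    rows        : List (List (Fin (sum μ)))
    .shape      : map length rows ≡ μ
    .distinct   : Unique (concat rows)
    .exhaustive : ∀ k → k ∈ concat rows
    .increasing : All (Linked _<_) rows
open RSYT using (rows)

-- Rows are counted from 0 at the top, so a smaller index is a higher row; the
-- value in the [] case is never reached in a tableau.
rowIndex : ∀ {n} → List (List (Fin n)) → Fin n → ℕ
rowIndex []       k = 0
rowIndex (r ∷ rs) k = if does (k ∈? r) then 0 else suc (rowIndex rs k)
  where open import Data.List.Membership.DecPropositional Fin._≟_ using (_∈?_)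

des : ∀ {μ} → RSYT μ → Subset (sum μ)
des T = tabulate λ i → does (rowIndex (rows T) i ℕ.<? rowIndex (rows T) (next i))

module _ {n : ℕ} where
  open InsertionSort (Fin.≤-decTotalOrder n) using (sort)
  open InsertionSortₚ (Fin.≤-decTotalOrder n) using (sort-↭; sort-↗)

  swapLabels : Fin n → Fin n → Fin n
  swapLabels i = Perm.transpose i (next i) Perm.⟨$⟩ʳ_

  interchangeRows : Fin n → List (List (Fin n)) → List (List (Fin n))
  interchangeRows i = map (λ r → sort (map (swapLabels i) r))

  module InterchangeProperties (i : Fin n) where

    swap-injective : ∀ {x y} → swapLabels i x ≡ swapLabels i y → x ≡ y
    swap-injective {x} {y} eq = trans (sym (Perm.inverseˡ π {x})) (trans (cong (π Perm.⟨$⟩ˡ_) eq) (Perm.inverseˡ π {y}))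
      where π = Perm.transpose i (next i)

    shape : ∀ rs → map length (interchangeRows i rs) ≡ map length rs
    shape []       = refl
    shape (r ∷ rs) = cong₂ _∷_
      (trans (↭.↭-length (sort-↭ (map (swapLabels i) r))) (List.length-map _ r)) (shape rs)

    concat-↭ : ∀ rs → concat (interchangeRows i rs) ↭ map (swapLabels i) (concat rs)
    concat-↭ []       = ↭-refl
    concat-↭ (r ∷ rs) = ↭-trans (↭.++⁺ (sort-↭ (map (swapLabels i) r)) (concat-↭ rs))
      (↭-reflexive (sym (List.map-++ (swapLabels i) r (concat rs))))

    distinct : ∀ rs → Unique (concat rs) → Unique (concat (interchangeRows i rs))
    distinct rs u = ↭ₛ.Unique-resp-↭ (setoid (Fin n)) (↭⇒↭ₛ (↭-sym (concat-↭ rs)))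
      (Unique.map⁺ swap-injective u)

    exhaustive : ∀ rs → (∀ k → k ∈ concat rs) → ∀ k → k ∈ concat (interchangeRows i rs)
    exhaustive rs e k = ↭.∈-resp-↭ (↭-sym (concat-↭ rs))
      (subst (_∈ _) (Perm.inverseʳ π) (Mem.∈-map⁺ (swapLabels i) (e (π Perm.⟨$⟩ˡ k))))
      where π = Perm.transpose i (next i)

    strict : ∀ {xs : List (Fin n)} → Unique xs → Linked Data.Fin.Base._≤_ xs → Linked _<_ xs
    strict u [] = []
    strict u [-] = [-]
    strict ((x≢ ∷ _) ∷ u) (x≤y ∷ l) = Fin.≤∧≢⇒< x≤y x≢ ∷ strict u l

    unique-++ˡ : ∀ (xs {ys} : List (Fin n)) → Unique (xs ++ ys) → Unique xs
    unique-++ˡ []       u       = []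
    unique-++ˡ (x ∷ xs) (p ∷ u) = All.++⁻ˡ xs p ∷ unique-++ˡ xs u

    unique-++ʳ : ∀ (xs {ys} : List (Fin n)) → Unique (xs ++ ys) → Unique ys
    unique-++ʳ []       u       = u
    unique-++ʳ (x ∷ xs) (_ ∷ u) = unique-++ʳ xs u

    increasing : ∀ rs → Unique (concat (interchangeRows i rs)) →
                 All (Linked _<_) (interchangeRows i rs)
    increasing []       u = []
    increasing (r ∷ rs) u =
      strict (unique-++ˡ _ u) (sort-↗ (map (swapLabels i) r)) ∷
      increasing rs (unique-++ʳ (sort (map (swapLabels i) r)) u)

    swap-involutive : ∀ k → swapLabels i (swapLabels i k) ≡ k
    swap-involutive k with k Fin.≟ i
    ... | yes refl with next k Fin.≟ k
    ...   | yes eq = eq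
    ...   | no  _ rewrite dec-true (next k Fin.≟ next k) refl = refl
    swap-involutive k | no k≢i with k Fin.≟ next i
    ...   | yes refl rewrite dec-true (i Fin.≟ i) refl = refl
    ...   | no  k≢j rewrite dec-false (k Fin.≟ i) k≢i | dec-false (k Fin.≟ next i) k≢j = refl

    row-involutive : ∀ r → Linked _<_ r → sort (map (swapLabels i) (sort (map (swapLabels i) r))) ≡ r
    row-involutive r inc = Pointwise.Pointwise-≡⇒≡ (Sorted.↗↭↗⇒≋ (Fin.≤-totalOrder n)
      (sort-↗ (map (swapLabels i) (sort (map (swapLabels i) r)))) (Linked.map ℕ.<⇒≤ inc)
      (↭⇒↭ₛ (↭-trans (sort-↭ _) (↭-trans (↭.map⁺ (swapLabels i) (sort-↭ _))
        (subst (_↭ r) (sym (trans (sym (List.map-∘ r)) (trans (List.map-cong swap-involutive r) (List.map-id r))))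
          ↭-refl)))))

    rows-involutive : ∀ rs → All (Linked _<_) rs → interchangeRows i (interchangeRows i rs) ≡ rs
    rows-involutive []       []       = refl
    rows-involutive (r ∷ rs) (p ∷ ps) = cong₂ _∷_ (row-involutive r p) (rows-involutive rs ps)

interchange : ∀ {μ} → Fin (sum μ) → RSYT μ → RSYT μ
interchange i (mkRSYT rs sh d e _) = mkRSYT (interchangeRows i rs)
  (trans (P.shape rs) sh) (P.distinct rs d) (P.exhaustive rs e) (P.increasing rs (P.distinct rs d))
  where module P = InterchangeProperties i

KnuthMove : ∀ {μ} → RSYT μ → RSYT μ → Set
KnuthMove T T′ = Incomparable (des T) (des T′) × ∃[ i ] T′ ≡ interchange i T

rows-injective : ∀ {μ} (T T′ : RSYT μ) → rows T ≡ rows T′ → T ≡ T′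
rows-injective (mkRSYT _ _ _ _ _) (mkRSYT _ _ _ _ _) refl = refl

_≟ᵀ_ : ∀ {μ} → DecidableEquality (RSYT μ)
T ≟ᵀ T′ = map′ (rows-injective T T′) (cong rows)
  (List.≡-dec (List.≡-dec Fin._≟_) (rows T) (rows T′))

interchange-involutive : ∀ {μ} (i : Fin (sum μ)) (T : RSYT μ) → interchange i (interchange i T) ≡ T
interchange-involutive i T@(mkRSYT rs _ _ _ inc) = rows-injective _ T
  (recompute (List.≡-dec (List.≡-dec Fin._≟_) _ _) (InterchangeProperties.rows-involutive i rs inc))

knuthMove-sym : ∀ {μ} {T T′ : RSYT μ} → KnuthMove T T′ → KnuthMove T′ T
knuthMove-sym {T = T} ((p , r) , i , refl) = (r , p) , i , sym (interchange-involutive i T)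

knuthMove? : ∀ {μ} (T T′ : RSYT μ) → Dec (KnuthMove T T′)
knuthMove? T T′ =
  (¬? (des T ⊆? des T′) ×-dec ¬? (des T′ ⊆? des T)) ×-dec
  Fin.any? (λ i → T′ ≟ᵀ interchange i T)

𝒟 : (μ : List ℕ) → LabeledGraph (sum μ)
𝒟 μ = record
  { V = RSYT μ
  ; _≟_ = _≟ᵀ_
  ; m = m
  ; τ = des
  ; nbrs = λ T → deduplicate _≟ᵀ_ (candidates T)
  ; nbrs-unique = λ T → DecUnique.deduplicate-! _≟ᵀ_ (candidates T)
  ; nbrs-complete = λ T T′ → λ where
      (inj₁ p) → complete T T′ (edge T T′ p)
      (inj₂ p) → complete T T′ (knuthMove-sym (edge T′ T p))
  }
  where
  m : RSYT μ → RSYT μ → Laurent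
  m T T′ = indicator (knuthMove? T T′)

  candidates : RSYT μ → List (RSYT μ)
  candidates T = map (λ i → interchange i T) (allFin (sum μ))

  edge : ∀ T T′ → ¬ m T T′ ≈ᴸ 0ᴸ → KnuthMove T T′
  edge T T′ = indicator≉0 (knuthMove? T T′)

  complete : ∀ T T′ → KnuthMove T T′ → T′ ∈ deduplicate _≟ᵀ_ (candidates T)
  complete T T′ (_ , i , refl) = Mem.∈-deduplicate⁺ _≟ᵀ_ (Mem.∈-map⁺ _ (Mem.∈-allFin i))

{-# OPTIONS --safe #-}
module Submission where

-- Write a two-row tableau as a cyclic word in U (top row) and D (bottom row). Descents are the
-- factors UD ("cups"), and Knuth moves slide a cup past a letter: UDx ↔ xUD. Specialising q½ to 1,
-- the braid relations give three rules for a reduced nb-admissible W-graph: the compatibility rule,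
-- the bonding rule (the arrows between the descent i and a bonded descent j are simple edges forming
-- a perfect matching, hence Knuth moves), and the invariance of m(u ▷ v) under sliding the same cup
-- of u and v as long as it stays away from a descent i ∈ τ(u) ∖ τ(v).
--
-- Fix i ∉ τ(v) and read v as x y Z starting at position i. Sliding cups inside Z brings Z to a normal
-- form Dˢ(UD)ᵏUᵗ. If y = U and s > 0, or x = D and t > 0, then v acquires a
-- descent next to i and the bonding rule determines m(u ▷ v) for all u with i ∈ τ(u). Otherwise
-- v = D U (UD)ᵏ; if m(u ▷ v) ≠ 0, compatibility forces u = (UD)ᵏ⁺¹, while v slides to (UD)ᵏ⁺¹ read
-- from i + 1. Every word slides to one of these two, so the graph is connected. In a disconnected
-- graph each m(u ▷ v) is therefore 0 or forced.

open import Defs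
open import Algebra.Bundles using (AbelianGroup)
open import Algebra.Module.Structures using (IsLeftModule)
import Algebra.Properties.Group
open import Data.Bool.Base using (Bool; true; false; if_then_else_)
open import Data.Bool.Properties using (∨-zeroʳ)
open import Data.Fin.Base using (Fin; toℕ; _<_)
import Data.Fin.Properties as Fin
open import Data.Fin.Subset using (Subset; _∈_; _∉_; _⊆_)
open import Data.Fin.Subset.Properties using (_∈?_)
open import Data.Integer.Base as ℤ using (ℤ; +_; 0ℤ; 1ℤ)
import Data.Integer.Properties as ℤ
open import Data.Integer.Tactic.RingSolver using (solve-∀)
open import Data.List.Base using (List; []; _∷_; _++_; map; filter; length; concat; concatMap; applyUpTo; replicate)
import Data.List.Membership.DecPropositional as DecMembership
open import Data.List.Membership.Propositional using () renaming (_∈_ to _∈ˡ_)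
import Data.List.Membership.Propositional.Properties as Mem
open import Data.List.Membership.Propositional.Properties.WithK using (unique∧set⇒bag)
import Data.List.Properties as List
open import Data.List.Relation.Binary.BagAndSetEquality using (∼bag⇒↭)
open import Data.List.Relation.Binary.Permutation.Propositional using (_↭_; ↭-sym; ↭⇒↭ₛ)
import Data.List.Relation.Binary.Permutation.Propositional.Properties as ↭
import Data.List.Relation.Binary.Pointwise as Pointwise
open import Data.List.Relation.Unary.All as All using (All; []; _∷_)
open import Data.List.Relation.Unary.AllPairs as AllPairs using ([]; _∷_)
open import Data.List.Relation.Unary.Any using (here; there)
open import Data.List.Relation.Unary.Linked as Linked using (Linked)
import Data.List.Relation.Unary.Linked.Properties as Linked
import Data.List.Relation.Unary.Sorted.TotalOrder.Properties as Sorted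
open import Data.List.Relation.Unary.Unique.Propositional using (Unique)
import Data.List.Relation.Unary.Unique.Propositional.Properties as Unique
import Data.List.Sort.InsertionSort as InsertionSort
import Data.List.Sort.InsertionSort.Properties as InsertionSortₚ
open import Data.Nat.Base as ℕ using (ℕ; zero; suc; _+_; _*_; _∸_; _≤_; z≤n; s≤s)
open import Data.Nat.DivMod using (_%_; m<n⇒m%n≡m; %-distribˡ-+; [m+n]%n≡m%n; m%n<n)
open import Data.Nat.ListAction using (sum)
import Data.Nat.ListAction.Properties as Sum
import Data.Nat.Properties as ℕ
open import Data.Product.Base using (_×_; _,_; proj₁; proj₂; ∃-syntax)
open import Data.Sum.Base using (_⊎_; inj₁; inj₂)
import Data.Vec.Properties as Vec
open import Function.Base using (_∘_)
open import Function.Bundles using (_⇔_; mk⇔; module Inverse)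
open import Function.Construct.Composition using (_⇔-∘_; _↔-∘_)
open import Function.Construct.Identity using (↔-id)
open import Function.Construct.Symmetry using (⇔-sym)
open import Function.Related.TypeIsomorphisms using (¬-cong-⇔)
open import Relation.Binary.Construct.Closure.Equivalence as Eq using (EqClosure)
open import Relation.Binary.Construct.Closure.ReflexiveTransitive using (ε; _◅_; _◅◅_)
open import Relation.Binary.Construct.Closure.Symmetric using (fwd; bwd)
open import Relation.Binary.PropositionalEquality
open import Relation.Nullary using (¬_; Dec; yes; no; does; contradiction)
open import Relation.Nullary.Decidable using (¬?; _×-dec_; recompute; decidable-stable; dec-true; dec-false; does-⇔; toSum)

open LaurentProperties using (1≉0; ≈-refl; ≈-sym; ≈-trans; ≈-reflexive)

private module ℤ-Group = Algebra.Properties.Group (AbelianGroup.group ℤ.+-0-abelianGroup)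

-- Relations at q = 1

-- The ring homomorphism q½ ↦ 1.
augment : Laurent → ℤ
augment []            = 0ℤ
augment ((c , _) ∷ f) = c ℤ.+ augment f

augment-++ : ∀ f g → augment (f ++ g) ≡ augment f ℤ.+ augment g
augment-++ []            g = sym (ℤ.+-identityˡ _)
augment-++ ((c , _) ∷ f) g = trans (cong (ℤ._+_ c) (augment-++ f g)) (sym (ℤ.+-assoc c _ _))

augment-neg : ∀ f → augment (-ᴸ f) ≡ ℤ.- augment f
augment-neg []            = refl
augment-neg ((c , _) ∷ f) = trans (cong (ℤ._+_ (ℤ.- c)) (augment-neg f)) (sym (ℤ.neg-distrib-+ c (augment f)))

augment-monomial-* : ∀ x g → augment (map (mulMonomial x) g) ≡ proj₁ x ℤ.* augment g
augment-monomial-* x []            = sym (ℤ.*-zeroʳ (proj₁ x))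
augment-monomial-* x ((c , _) ∷ g) =
  trans (cong (ℤ._+_ (proj₁ x ℤ.* c)) (augment-monomial-* x g)) (sym (ℤ.*-distribˡ-+ (proj₁ x) c (augment g)))

augment-* : ∀ f g → augment (f *ᴸ g) ≡ augment f ℤ.* augment g
augment-* []      g = refl
augment-* (x ∷ f) g = trans (augment-++ (map (mulMonomial x) g) (f *ᴸ g))
  (trans (cong₂ ℤ._+_ (augment-monomial-* x g) (augment-* f g)) (sym (ℤ.*-distribʳ-+ (augment g) (proj₁ x) (augment f))))

private
  dropExponent : ℤ → Laurent → Laurent
  dropExponent e = filter (λ x → ¬? (proj₂ x ℤ.≟ e))

augment-split : ∀ e f → augment f ≡ coeffᴸ f e ℤ.+ augment (dropExponent e f)
augment-split e [] = refl
augment-split e ((c , k) ∷ f) with k ℤ.≟ e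
... | yes _ = trans (cong (ℤ._+_ c) (augment-split e f)) (sym (ℤ.+-assoc c _ _))
... | no  _ = trans (cong (ℤ._+_ c) (augment-split e f)) (lemma c (coeffᴸ f e) _)
  where
  lemma : ∀ x y z → x ℤ.+ (y ℤ.+ z) ≡ 0ℤ ℤ.+ y ℤ.+ (x ℤ.+ z)
  lemma = solve-∀

coeff-dropExponent : ∀ e f k → coeffᴸ (dropExponent e f) k ≡ (if does (k ℤ.≟ e) then 0ℤ else coeffᴸ f k)
coeff-dropExponent e [] k with does (k ℤ.≟ e)
... | true  = refl
... | false = refl
coeff-dropExponent e ((c , j) ∷ f) k with j ℤ.≟ e | coeff-dropExponent e f k
... | yes refl | ih with k ℤ.≟ e
...   | yes _   = ih
...   | no  k≢e rewrite dec-false (e ℤ.≟ k) (k≢e ∘ sym) = trans ih (sym (ℤ.+-identityˡ _))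
coeff-dropExponent e ((c , j) ∷ f) k | no j≢e | ih with k ℤ.≟ e
...   | yes refl rewrite dec-false (j ℤ.≟ k) j≢e = trans (ℤ.+-identityˡ _) ih
...   | no  _    = cong (ℤ._+_ (if does (j ℤ.≟ k) then c else 0ℤ)) ih

-- Vanishing coefficients do not make the list empty, since terms may cancel. The induction is on
-- the length bound `b`: dropping every term that has the exponent of the first one shortens the
-- list, and the dropped terms add up to a coefficient, hence to 0.
augment-vanishes : ∀ b f → length f ≤ b → (∀ k → coeffᴸ f k ≡ 0ℤ) → augment f ≡ 0ℤ
augment-vanishes b []                _ _ = refl
augment-vanishes (suc b) f@((_ , e) ∷ _) l z =
  trans (augment-split e f) (cong₂ ℤ._+_ (z e) (augment-vanishes b (dropExponent e f) shorter vanish))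
  where
  shorter : length (dropExponent e f) ≤ b
  shorter = ℕ.≤-pred (ℕ.≤-trans (List.filter-notAll (λ x → ¬? (proj₂ x ℤ.≟ e)) f (here (λ ¬p → ¬p refl))) l)
  vanish : ∀ k → coeffᴸ (dropExponent e f) k ≡ 0ℤ
  vanish k rewrite coeff-dropExponent e f k with does (k ℤ.≟ e)
  ... | true  = refl
  ... | false = z k

-- Two lists for the same Laurent polynomial differ by `f ++ -ᴸ g`, whose coefficients all vanish,
-- and `augment` is additive.
augment-cong : ∀ {f g} → f ≈ᴸ g → augment f ≡ augment g
augment-cong {f} {g} p = trans (lemma (augment f) (augment g))
  (trans (cong (ℤ._+ augment g) (trans (cong (ℤ._+_ (augment f)) (sym (augment-neg g))) (trans (sym (augment-++ f (-ᴸ g)))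
    (augment-vanishes _ (f ++ -ᴸ g) ℕ.≤-refl vanish)))) (ℤ.+-identityˡ (augment g)))
  where
  open LaurentProperties using (coeff-++; coeff-neg)
  lemma : ∀ x y → x ≡ x ℤ.+ ℤ.- y ℤ.+ y
  lemma = solve-∀
  vanish : ∀ k → coeffᴸ (f ++ -ᴸ g) k ≡ 0ℤ
  vanish k = trans (coeff-++ f (-ᴸ g) k)
    (trans (cong₂ ℤ._+_ (coeffᴸ-≡ p k) (coeff-neg g k)) (ℤ.+-inverseʳ (coeffᴸ g k)))

module _ {A : Set} where

  Σ[_] : List A → (A → ℤ) → ℤ
  Σ[ [] ]     f = 0ℤ
  Σ[ x ∷ xs ] f = f x ℤ.+ Σ[ xs ] f

  Σ-cong : ∀ xs {f g} → (∀ {x} → x ∈ˡ xs → f x ≡ g x) → Σ[ xs ] f ≡ Σ[ xs ] g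
  Σ-cong []       p = refl
  Σ-cong (x ∷ xs) p = cong₂ ℤ._+_ (p (here refl)) (Σ-cong xs (p ∘ there))

  Σ-zero : ∀ xs → Σ[ xs ] (λ _ → 0ℤ) ≡ 0ℤ
  Σ-zero []       = refl
  Σ-zero (x ∷ xs) = trans (ℤ.+-identityˡ _) (Σ-zero xs)

  Σ-nonneg : ∀ xs {f} → (∀ {x} → x ∈ˡ xs → 0ℤ ℤ.≤ f x) → 0ℤ ℤ.≤ Σ[ xs ] f
  Σ-nonneg []       p = ℤ.≤-refl
  Σ-nonneg (x ∷ xs) p = ℤ.+-mono-≤ (p (here refl)) (Σ-nonneg xs (p ∘ there))

module _ {n} {M : CoxeterMatrix n} {Γ : LabeledGraph n} (W : IsWGraph M Γ) (nb : NbAdmissible Γ) where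

  open LabeledGraph Γ
  open IsWGraph W
  open NbAdmissible nb
  open Hecke M using (T; _⊗_; scalar; alternating; braid; scalar-comm)
  open FormalSums laurentRing _≟_
  open IsLeftModule isLeftModule using (*ₗ-cong; *ₗ-zeroʳ; *ₗ-assoc; *ₗ-identityˡ; *ₗ-distribˡ; ≈ᴹ-refl; ≈ᴹ-sym; ≈ᴹ-trans)
    renaming (+ᴹ-cong to ++-cong)

  weight : V → V → ℕ
  weight u v = proj₁ (natural u v)

  weight-≈ : ∀ u v → m u v ≈ᴸ fromℕᴸ (weight u v)
  weight-≈ u v = proj₂ (natural u v)

  -- The linear extension of `φ`, evaluated at q½ = 1. For `φ = δ v` it extracts the coefficient of
  -- v, which turns identities in the module into identities of integers.
  pair : (V → ℤ) → FormalSum → ℤ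
  pair φ []            = 0ℤ
  pair φ ((r , y) ∷ f) = augment r ℤ.* φ y ℤ.+ pair φ f

  pair-++ : ∀ φ f g → pair φ (f ++ g) ≡ pair φ f ℤ.+ pair φ g
  pair-++ φ []            g = sym (ℤ.+-identityˡ _)
  pair-++ φ ((r , y) ∷ f) g = trans (cong (ℤ._+_ (augment r ℤ.* φ y)) (pair-++ φ f g)) (sym (ℤ.+-assoc (augment r ℤ.* φ y) _ _))

  pair-· : ∀ φ r f → pair φ (r · f) ≡ augment r ℤ.* pair φ f
  pair-· φ r []            = sym (ℤ.*-zeroʳ (augment r))
  pair-· φ r ((s , y) ∷ f) = trans (cong₂ ℤ._+_ (cong (ℤ._* φ y) (augment-* r s)) (pair-· φ r f))
    (lemma (augment r) (augment s) (φ y) (pair φ f))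
    where
    lemma : ∀ r s x y → r ℤ.* s ℤ.* x ℤ.+ r ℤ.* y ≡ r ℤ.* (s ℤ.* x ℤ.+ y)
    lemma = solve-∀

  δ : V → V → ℤ
  δ v w = if does (w ≟ v) then 1ℤ else 0ℤ

  δ-same : ∀ v → δ v v ≡ 1ℤ
  δ-same v rewrite dec-true (v ≟ v) refl = refl

  δ-diff : ∀ {v w} → w ≢ v → δ v w ≡ 0ℤ
  δ-diff {v} {w} p rewrite dec-false (w ≟ v) p = refl

  augment-coeff : ∀ f v → augment (coeff f v) ≡ pair (δ v) f
  augment-coeff []            v = refl
  augment-coeff ((r , y) ∷ f) v = trans (augment-++ (if does (y ≟ v) then r else 0ᴸ) (coeff f v)) (cong₂ ℤ._+_ head (augment-coeff f v))
    where
    head : augment (if does (y ≟ v) then r else 0ᴸ) ≡ augment r ℤ.* δ v y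
    head with does (y ≟ v)
    ... | true  = sym (ℤ.*-identityʳ (augment r))
    ... | false = sym (ℤ.*-zeroʳ (augment r))

  extend : Fin n → FormalSum → FormalSum
  extend i = concatMap (λ (r , y) → r · T-formula i y)

  single-· : ∀ r y → r · basis y ≋ (r , y) ∷ []
  single-· r y = mk≋ λ x → LaurentProperties.+-cong (lemma x) LaurentProperties.≈-refl
    where
    lemma : ∀ x → (if does (y ≟ x) then r *ᴸ 1ᴸ else 0ᴸ) ≈ᴸ (if does (y ≟ x) then r else 0ᴸ)
    lemma x with does (y ≟ x)
    ... | true  = LaurentProperties.≈-trans (LaurentProperties.*-comm r 1ᴸ)
                    (LaurentProperties.≈-reflexive (LaurentProperties.*-identityˡ r))
    ... | false = LaurentProperties.≈-refl

  ·-cong : ∀ r {f g} → f ≋ g → r · f ≋ r · g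
  ·-cong r {f} {g} p = ≈ᴹ-trans (≈ᴹ-sym (scalar-*ₗ r f)) (≈ᴹ-trans (*ₗ-cong Hecke.≈-refl p) (scalar-*ₗ r g))

  -- The action of `T i` is prescribed on basis vectors only. The coefficient `r` is written as the
  -- action of `scalar r`, which is central in the Hecke algebra and so moves past `T i`.
  T-single : ∀ i r y → T i *ₗ ((r , y) ∷ []) ≋ r · T-formula i y
  T-single i r y =
    ≈ᴹ-trans (*ₗ-cong Hecke.≈-refl (≈ᴹ-sym (≈ᴹ-trans (scalar-*ₗ r (basis y)) (single-· r y))))
    (≈ᴹ-trans (≈ᴹ-sym (*ₗ-assoc (T i) (scalar r) (basis y)))
    (≈ᴹ-trans (*ₗ-cong (Hecke.≈-sym (scalar-comm r (T i))) ≈ᴹ-refl)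
    (≈ᴹ-trans (*ₗ-assoc (scalar r) (T i) (basis y))
    (≈ᴹ-trans (scalar-*ₗ r _) (·-cong r (T-*ₗ i y))))))

  T-extend : ∀ i f → T i *ₗ f ≋ extend i f
  T-extend i []            = *ₗ-zeroʳ (T i)
  T-extend i ((r , y) ∷ f) =
    ≈ᴹ-trans (*ₗ-distribˡ (T i) ((r , y) ∷ []) f) (++-cong (T-single i r y) (T-extend i f))

  act-⊗ : ∀ i x {f u} → x *ₗ basis u ≋ f → (T i ⊗ x) *ₗ basis u ≋ extend i f
  act-⊗ i x {f} {u} p = ≈ᴹ-trans (*ₗ-assoc (T i) x (basis u))
    (≈ᴹ-trans (*ₗ-cong Hecke.≈-refl p) (T-extend i f))

  alternatingSum : ℕ → Fin n → Fin n → V → FormalSum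
  alternatingSum zero    i j u = basis u
  alternatingSum (suc k) i j u = extend i (alternatingSum k j i u)

  alternating-act : ∀ k i j u → alternating k i j *ₗ basis u ≋ alternatingSum k i j u
  alternating-act zero    i j u = *ₗ-identityˡ (basis u)
  alternating-act (suc k) i j u = act-⊗ i _ (alternating-act k j i u)

  -- The action of Tᵢ at q = 1 on functions of the vertices, which is dual to the action on
  -- formal sums.
  S : Fin n → (V → ℤ) → V → ℤ
  S i φ u = pair φ (T-formula i u)

  pair-extend : ∀ φ i f → pair φ (extend i f) ≡ pair (S i φ) f
  pair-extend φ i []            = refl
  pair-extend φ i ((r , y) ∷ f) = trans (pair-++ φ (r · T-formula i y) (extend i f))
    (cong₂ ℤ._+_ (pair-· φ r (T-formula i y)) (pair-extend φ i f))

  pair-basis : ∀ φ u → pair φ (basis u) ≡ φ u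
  pair-basis φ u = trans (ℤ.+-identityʳ _) (ℤ.*-identityˡ (φ u))

  braid-at : ∀ k i j → M i j ≡ k → ∀ u v →
    pair (δ v) (alternatingSum k i j u) ≡ pair (δ v) (alternatingSum k j i u)
  braid-at _ i j refl u v = trans (sym (augment-coeff (alternatingSum (M i j) i j u) v))
    (trans (augment-cong (coeff-≈ sums v)) (augment-coeff (alternatingSum (M i j) j i u) v))
    where
    sums : alternatingSum (M i j) i j u ≋ alternatingSum (M i j) j i u
    sums = ≈ᴹ-trans (≈ᴹ-sym (alternating-act (M i j) i j u))
      (≈ᴹ-trans (*ₗ-cong (braid i j) ≈ᴹ-refl) (alternating-act (M i j) j i u))

  -- Passing to the dual reverses the order of the factors, so the outermost factor `T i` is the
  -- first to act on `φ`.
  alternatingS : ℕ → Fin n → Fin n → (V → ℤ) → V → ℤ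
  alternatingS zero    i j φ = φ
  alternatingS (suc k) i j φ = alternatingS k j i (S i φ)

  pair-alternating : ∀ k i j φ u → pair φ (alternatingSum k i j u) ≡ alternatingS k i j φ u
  pair-alternating zero    i j φ u = pair-basis φ u
  pair-alternating (suc k) i j φ u =
    trans (pair-extend φ i (alternatingSum k j i u)) (pair-alternating k j i (S i φ) u)

  braidS : ∀ k {i j} → M i j ≡ k → ∀ u v → alternatingS k i j (δ v) u ≡ alternatingS k j i (δ v) u
  braidS k {i} {j} p u v = trans (sym (pair-alternating k i j (δ v) u))
    (trans (braid-at k i j p u v) (pair-alternating k j i (δ v) u))

  braid₂ : ∀ {i j} → M i j ≡ 2 → ∀ u v → S j (S i (δ v)) u ≡ S i (S j (δ v)) u
  braid₂ = braidS 2

  braid₃ : ∀ {i j} → M i j ≡ 3 → ∀ u v → S i (S j (S i (δ v))) u ≡ S j (S i (S j (δ v))) u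
  braid₃ = braidS 3

  outs : Fin n → V → List V
  outs i u = filter (λ w → ¬? (i ∈? τ w)) (nbrs u)

  Out : Fin n → V → (V → ℤ) → ℤ
  Out i u φ = Σ[ outs i u ] (λ w → + weight u w ℤ.* φ w)

  S-∉ : ∀ {i u} → i ∉ τ u → ∀ φ → S i φ u ≡ φ u
  S-∉ {i} {u} i∉ φ rewrite dec-false (i ∈? τ u) i∉ = trans (ℤ.+-identityʳ _) (ℤ.*-identityˡ (φ u))

  S-∈ : ∀ {i u} → i ∈ τ u → ∀ φ → S i φ u ≡ ℤ.- φ u ℤ.+ Out i u φ
  S-∈ {i} {u} i∈ φ rewrite dec-true (i ∈? τ u) i∈ =
    cong₂ ℤ._+_ (ℤ.-1*i≡-i (φ u)) (sums (outs i u))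
    where
    sums : ∀ xs → pair φ (q½ · map (λ v → m u v , v) xs) ≡ Σ[ xs ] (λ w → + weight u w ℤ.* φ w)
    sums []       = refl
    sums (w ∷ xs) = cong₂ ℤ._+_ (cong (ℤ._* φ w) (trans (augment-* q½ (m u w)) (trans (ℤ.*-identityˡ _) (trans (augment-cong (weight-≈ u w)) (ℤ.+-identityʳ (+ weight u w)))))) (sums xs)

  weight-unique : ∀ {u v k} → m u v ≈ᴸ fromℕᴸ k → weight u v ≡ k
  weight-unique {u} {v} {k} p = ℤ.+-injective (trans (sym (ℤ.+-identityʳ _))
    (trans (sym (augment-cong (weight-≈ u v))) (trans (augment-cong p) (ℤ.+-identityʳ (+ k)))))

  ≈0⇒weight≡0 : ∀ {u v} → m u v ≈ᴸ 0ᴸ → weight u v ≡ 0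
  ≈0⇒weight≡0 {u} {v} p = ℤ.+-injective (trans (sym (ℤ.+-identityʳ _))
    (trans (sym (augment-cong (weight-≈ u v))) (augment-cong p)))

  weight-sym : ∀ {u v} → Incomparable (τ u) (τ v) → weight u v ≡ weight v u
  weight-sym {u} {v} p = weight-unique (LaurentProperties.≈-trans (symmetric u v p) (weight-≈ v u))

  Σ-remove : ∀ {xs x} {f g : V → ℤ} → Unique xs → x ∈ˡ xs → g x ≡ 0ℤ → (∀ {w} → w ≢ x → g w ≡ f w) →
    Σ[ xs ] f ≡ f x ℤ.+ Σ[ xs ] g
  Σ-remove {x ∷ xs} {f = f} {g} (x∉ ∷ _) (here refl) gx g≡f = cong (ℤ._+_ (f x))
    (sym (trans (cong (ℤ._+ Σ[ xs ] g) gx) (trans (ℤ.+-identityˡ _)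
      (Σ-cong xs (λ w∈ → g≡f (λ w≡x → All.lookup x∉ w∈ (sym w≡x)))))))
  Σ-remove {y ∷ xs} {x} {f} {g} (y∉ ∷ u) (there x∈) gx g≡f =
    trans (cong₂ ℤ._+_ (sym (g≡f (All.lookup y∉ x∈))) (Σ-remove u x∈ gx g≡f)) (lemma (g y) (f x) (Σ[ xs ] g))
    where
    lemma : ∀ a b c → a ℤ.+ (b ℤ.+ c) ≡ b ℤ.+ (a ℤ.+ c)
    lemma = solve-∀

  -- Setting a value to 0, rather than deleting a vertex from the list of summation, leaves the
  -- shape `Out i u` intact, so that vertices can be split off one after another.
  punch : (V → ℤ) → V → V → ℤ
  punch φ x w = if does (w ≟ x) then 0ℤ else φ w

  punch-same : ∀ φ x → punch φ x x ≡ 0ℤ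
  punch-same φ x rewrite dec-true (x ≟ x) refl = refl

  punch-diff : ∀ φ {x w} → w ≢ x → punch φ x w ≡ φ w
  punch-diff φ {x} {w} p rewrite dec-false (w ≟ x) p = refl

  term-zero : ∀ k {x} → k ≡ 0 ⊎ x ≡ 0ℤ → + k ℤ.* x ≡ 0ℤ
  term-zero _ {x} (inj₁ refl) = refl
  term-zero k     (inj₂ refl) = ℤ.*-zeroʳ (+ k)

  ∈-outs : ∀ {i u w} → w ∈ˡ outs i u → i ∉ τ w
  ∈-outs {i} {u} w∈ = proj₂ (Mem.∈-filter⁻ (λ w → ¬? (i ∈? τ w)) {xs = nbrs u} w∈)

  Out-zero : ∀ {i u φ} → (∀ {w} → i ∉ τ w → weight u w ≡ 0 ⊎ φ w ≡ 0ℤ) → Out i u φ ≡ 0ℤ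
  Out-zero {i} {u} p = trans (Σ-cong (outs i u) (λ {w} w∈ → term-zero (weight u w) (p (∈-outs {i} {u} w∈)))) (Σ-zero (outs i u))

  -- A vertex x of nonzero weight occurs in `nbrs u`, exactly once. If the weight is 0, x may or may
  -- not be listed, but its term is 0 before and after punching.
  Out-point : ∀ {i u x} φ → i ∉ τ x → Out i u φ ≡ + weight u x ℤ.* φ x ℤ.+ Out i u (punch φ x)
  Out-point {i} {u} {x} φ i∉ with weight u x ℕ.≟ 0
  ... | no w≢0 = Σ-remove (Unique.filter⁺ (λ w → ¬? (i ∈? τ w)) (nbrs-unique u))
    (Mem.∈-filter⁺ (λ w → ¬? (i ∈? τ w)) (nbrs-complete u x (inj₁ (w≢0 ∘ ≈0⇒weight≡0))) i∉)
    (term-zero (weight u x) (inj₂ (punch-same φ x)))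
    (λ {w} w≢ → cong (+ weight u w ℤ.*_) (punch-diff φ w≢))
  ... | yes w≡0 = trans (Σ-cong (outs i u) (λ {w} _ → pointwise w))
    (sym (trans (cong (ℤ._+ Out i u (punch φ x)) (term-zero (weight u x) (inj₁ w≡0))) (ℤ.+-identityˡ _)))
    where
    pointwise : ∀ w → + weight u w ℤ.* φ w ≡ + weight u w ℤ.* punch φ x w
    pointwise w with w ≟ x
    ... | yes refl = trans (term-zero (weight u w) (inj₁ w≡0)) (sym (term-zero (weight u w) {0ℤ} (inj₂ refl)))
    ... | no  _    = refl

  Out-single : ∀ {i u x} φ → i ∉ τ x → (∀ {w} → i ∉ τ w → w ≢ x → weight u w ≡ 0 ⊎ φ w ≡ 0ℤ) →
    Out i u φ ≡ + weight u x ℤ.* φ x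
  Out-single {i} {u} {x} φ i∉ p =
    trans (Out-point φ i∉) (trans (cong (ℤ._+_ (+ weight u x ℤ.* φ x)) (Out-zero rest)) (ℤ.+-identityʳ _))
    where
    rest : ∀ {w} → i ∉ τ w → weight u w ≡ 0 ⊎ punch φ x w ≡ 0ℤ
    rest {w} i∉w with w ≟ x
    ... | yes _  = inj₂ refl
    ... | no w≢x = p i∉w w≢x

  Out-two : ∀ {i u x y} φ → i ∉ τ x → i ∉ τ y → y ≢ x →
    (∀ {w} → i ∉ τ w → w ≢ x → w ≢ y → weight u w ≡ 0 ⊎ φ w ≡ 0ℤ) →
    Out i u φ ≡ + weight u x ℤ.* φ x ℤ.+ + weight u y ℤ.* φ y
  Out-two {i} {u} {x} {y} φ i∉x i∉y y≢x p =
    trans (Out-point φ i∉x) (cong (ℤ._+_ (+ weight u x ℤ.* φ x))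
      (trans (Out-single (punch φ x) i∉y rest) (cong (+ weight u y ℤ.*_) (punch-diff φ y≢x))))
    where
    rest : ∀ {w} → i ∉ τ w → w ≢ y → weight u w ≡ 0 ⊎ punch φ x w ≡ 0ℤ
    rest {w} i∉w w≢y with w ≟ x
    ... | yes _  = inj₂ refl
    ... | no w≢x = p i∉w w≢x w≢y

  ∈∉⇒≢ : ∀ {i u v} → i ∈ τ u → i ∉ τ v → u ≢ v
  ∈∉⇒≢ i∈ i∉ refl = i∉ i∈

  -- The arrow sums in the formula for `T i` run over vertices without i in their label, so v never
  -- occurs in them; only the diagonal entry -1 is left.
  S-δ-∈ : ∀ {i v} → i ∈ τ v → ∀ w → S i (δ v) w ≡ ℤ.- δ v w
  S-δ-∈ {i} {v} i∈v w with toSum (i ∈? τ w)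
  ... | inj₁ i∈w = trans (S-∈ i∈w (δ v)) (trans
    (cong (ℤ._+_ (ℤ.- δ v w)) (Out-zero (λ i∉ → inj₂ (δ-diff (≢-sym (∈∉⇒≢ i∈v i∉)))))) (ℤ.+-identityʳ _))
  ... | inj₂ i∉w = trans (S-∉ i∉w (δ v)) (trans (δ-diff w≢v) (cong ℤ.-_ (sym (δ-diff w≢v))))
    where w≢v = ≢-sym (∈∉⇒≢ i∈v i∉w)

  S-δ-∉ : ∀ {i u v} → i ∈ τ u → i ∉ τ v → S i (δ v) u ≡ + weight u v
  S-δ-∉ {i} {u} {v} i∈u i∉v = begin
    S i (δ v) u                       ≡⟨ S-∈ i∈u (δ v) ⟩
    ℤ.- δ v u ℤ.+ Out i u (δ v)       ≡⟨ cong₂ (λ x y → ℤ.- x ℤ.+ y) (δ-diff (∈∉⇒≢ i∈u i∉v))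
                                           (Out-single (δ v) i∉v (λ _ w≢v → inj₂ (δ-diff w≢v))) ⟩
    0ℤ ℤ.+ + weight u v ℤ.* δ v v     ≡⟨ cong (λ x → 0ℤ ℤ.+ + weight u v ℤ.* x) (δ-same v) ⟩
    0ℤ ℤ.+ + weight u v ℤ.* 1ℤ        ≡⟨ ℤ.+-identityˡ (+ weight u v ℤ.* 1ℤ) ⟩
    + weight u v ℤ.* 1ℤ               ≡⟨ ℤ.*-identityʳ (+ weight u v) ⟩
    + weight u v                      ∎
    where open ≡-Reasoning

  pair-cong : ∀ {φ ψ} → (∀ w → φ w ≡ ψ w) → ∀ f → pair φ f ≡ pair ψ f
  pair-cong p []            = refl
  pair-cong p ((r , y) ∷ f) = cong₂ ℤ._+_ (cong (augment r ℤ.*_) (p y)) (pair-cong p f)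

  pair-neg : ∀ φ f → pair (λ w → ℤ.- φ w) f ≡ ℤ.- pair φ f
  pair-neg φ []            = refl
  pair-neg φ ((r , y) ∷ f) = trans (cong (ℤ._+_ (augment r ℤ.* (ℤ.- φ y))) (pair-neg φ f)) (lemma (augment r) (φ y) (pair φ f))
    where
    lemma : ∀ r x y → r ℤ.* (ℤ.- x) ℤ.+ ℤ.- y ≡ ℤ.- (r ℤ.* x ℤ.+ y)
    lemma = solve-∀

  S-cong : ∀ i {φ ψ} → (∀ w → φ w ≡ ψ w) → ∀ u → S i φ u ≡ S i ψ u
  S-cong i p u = pair-cong p (T-formula i u)

  S-neg : ∀ i φ u → S i (λ w → ℤ.- φ w) u ≡ ℤ.- S i φ u
  S-neg i φ u = pair-neg φ (T-formula i u)

  ≡neg⇒≡0 : ∀ {x} → x ≡ ℤ.- x → x ≡ 0ℤ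
  ≡neg⇒≡0 {+ zero} _ = refl

  -- The coefficient of v in the image of u is computed in both orders of the commuting operators.
  -- At q = 1, `T j` fixes u because j ∉ τ(u), and it negates the coefficient of v because j ∈ τ(v);
  -- hence the weight equals its own negative.
  compatibility : ∀ {i j u v} → M i j ≡ 2 → i ∈ τ u → j ∉ τ u → i ∉ τ v → j ∈ τ v → weight u v ≡ 0
  compatibility {i} {j} {u} {v} p i∈u j∉u i∉v j∈v = ℤ.+-injective (≡neg⇒≡0 (begin
    + weight u v                        ≡⟨ S-δ-∉ i∈u i∉v ⟨
    S i (δ v) u                         ≡⟨ S-∉ j∉u (S i (δ v)) ⟨
    S j (S i (δ v)) u                   ≡⟨ braid₂ p u v ⟩
    S i (S j (δ v)) u                   ≡⟨ S-cong i (S-δ-∈ j∈v) u ⟩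
    S i (λ w → ℤ.- δ v w) u             ≡⟨ S-neg i (δ v) u ⟩
    ℤ.- S i (δ v) u                     ≡⟨ cong ℤ.-_ (S-δ-∉ i∈u i∉v) ⟩
    ℤ.- (+ weight u v)                  ∎))
    where open ≡-Reasoning

  SimpleEdge : V → V → Set
  SimpleEdge u v = weight u v ≡ 1 × weight v u ≡ 1

  incomparable : ∀ {i j u v} → i ∈ τ u → j ∉ τ u → i ∉ τ v → j ∈ τ v → Incomparable (τ u) (τ v)
  incomparable i∈u j∉u i∉v j∈v = (λ u⊆v → i∉v (u⊆v i∈u)) , (λ v⊆u → j∉u (v⊆u j∈v))

  δ-nonneg : ∀ v w → 0ℤ ℤ.≤ δ v w
  δ-nonneg v w with does (w ≟ v)
  ... | true  = ℤ.+≤+ ℕ.z≤n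
  ... | false = ℤ.≤-refl

  punch-nonneg : ∀ {φ x w} → 0ℤ ℤ.≤ φ w → 0ℤ ℤ.≤ punch φ x w
  punch-nonneg {x = x} {w} p with does (w ≟ x)
  ... | true  = ℤ.≤-refl
  ... | false = p

  -- Braiding at the coefficient of u in TᵢTⱼTᵢ u says that Σ m(u ▷ x) m(x ▷ u) = 1 over the x with
  -- i ∉ τ(x) ∋ j; the simple edge to v already contributes 1.
  bonding : ∀ {i j u v w} → M i j ≡ 3 → i ∈ τ u → j ∉ τ u → i ∉ τ v → j ∈ τ v → i ∉ τ w → j ∈ τ w →
    SimpleEdge u v → w ≢ v → weight u w ≡ 0 × weight w u ≡ 0
  bonding {i} {j} {u} {v} {w} p i∈u j∉u i∉v j∈v i∉w j∈w (uv , vu) w≢v = uw≡0 , trans (sym uw≡wu) uw≡0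
    where
    open ≡-Reasoning
    χ rest : V → ℤ
    χ    = S j (δ u)
    rest = punch (punch χ v) w

    uw≡wu : weight u w ≡ weight w u
    uw≡wu = weight-sym (incomparable i∈u j∉u i∉w j∈w)

    -- The two sides of the braid relation at (u, u) are `S i χ u` and its negative: the factor
    -- `S i` applied to `δ u` gives a sign, and an outer `S j` evaluated at u does nothing.
    Sχ≡0 : S i χ u ≡ 0ℤ
    Sχ≡0 = ≡neg⇒≡0 (begin
      S i χ u                            ≡⟨ S-∉ j∉u (S i χ) ⟨
      S j (S i χ) u                      ≡⟨ braid₃ p u u ⟨
      S i (S j (S i (δ u))) u            ≡⟨ S-cong i (S-cong j (S-δ-∈ i∈u)) u ⟩
      S i (S j (λ x → ℤ.- δ u x)) u      ≡⟨ S-cong i (S-neg j (δ u)) u ⟩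
      S i (λ x → ℤ.- χ x) u              ≡⟨ S-neg i χ u ⟩
      ℤ.- S i χ u                        ∎)

    χ-∈ : ∀ {x} → j ∈ τ x → χ x ≡ + weight x u
    χ-∈ j∈x = S-δ-∉ j∈x j∉u

    -- Since `χ u` is 1, the vanishing of `S i χ u` says that `Out i u χ` is 1; the terms of v and w
    -- are then split off, leaving a nonnegative remainder.
    total : + 1 ℤ.+ (+ weight u w ℤ.* + weight w u ℤ.+ Out i u rest) ≡ + 1
    total = begin
      + 1 ℤ.+ (+ weight u w ℤ.* + weight w u ℤ.+ Out i u rest)
        ≡⟨ cong₂ ℤ._+_ (cong₂ (λ k l → + k ℤ.* + l) uv vu) (cong (ℤ._+ Out i u rest) (cong (+ weight u w ℤ.*_) (trans (punch-diff χ w≢v) (χ-∈ j∈w)))) ⟨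
      + weight u v ℤ.* + weight v u ℤ.+ (+ weight u w ℤ.* punch χ v w ℤ.+ Out i u rest)
        ≡⟨ cong₂ ℤ._+_ (cong (+ weight u v ℤ.*_) (χ-∈ j∈v)) (Out-point (punch χ v) i∉w) ⟨
      + weight u v ℤ.* χ v ℤ.+ Out i u (punch χ v)
        ≡⟨ Out-point χ i∉v ⟨
      Out i u χ
        ≡⟨ lemma (χ u) (Out i u χ) ⟩
      χ u ℤ.+ (ℤ.- χ u ℤ.+ Out i u χ)
        ≡⟨ cong₂ ℤ._+_ (trans (S-∉ j∉u (δ u)) (δ-same u)) (trans (sym (S-∈ i∈u χ)) Sχ≡0) ⟩
      + 1 ∎
      where
      lemma : ∀ x y → y ≡ x ℤ.+ (ℤ.- x ℤ.+ y)
      lemma = solve-∀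

    χ-nonneg : ∀ x → 0ℤ ℤ.≤ χ x
    χ-nonneg x with toSum (j ∈? τ x)
    ... | inj₁ j∈x rewrite χ-∈ j∈x = ℤ.+≤+ ℕ.z≤n
    ... | inj₂ j∉x rewrite S-∉ j∉x (δ u) = δ-nonneg u x

    rest-nonneg : 0ℤ ℤ.≤ Out i u rest
    rest-nonneg = Σ-nonneg (outs i u) (λ {x} _ → subst (ℤ._≤ + weight u x ℤ.* rest x) (ℤ.*-zeroʳ (+ weight u x))
      (ℤ.*-monoˡ-≤-nonNeg (+ weight u x) (punch-nonneg {punch χ v} {w} {x} (punch-nonneg {χ} {v} {x} (χ-nonneg x)))))

    square-zero : ∀ {k l r} → 0ℤ ℤ.≤ r → + 1 ℤ.+ (+ k ℤ.* + l ℤ.+ r) ≡ + 1 → k ≡ l → k ≡ 0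
    square-zero {zero}          _               _ _    = refl
    square-zero {suc k} {suc l} {+ r} (ℤ.+≤+ _) e refl = contradiction (ℤ.+-injective e) λ ()

    uw≡0 : weight u w ≡ 0
    uw≡0 = square-zero rest-nonneg total uw≡wu

  -- The braid relation TᵢTⱼ′ = Tⱼ′Tᵢ between u′ and v: on each side the bonding rule leaves, besides a
  -- common term, a single path, through u on one side and through v′ on the other.
  transport : ∀ {i j j′ u u′ v v′} → M i j ≡ 2 → M i j′ ≡ 2 → M j j′ ≡ 3 → M j′ j ≡ 3 →
    (∀ {w} → j′ ∈ τ w → j ∉ τ w) →
    i ∈ τ u → i ∈ τ u′ → i ∉ τ v → i ∉ τ v′ →
    j ∈ τ u → j′ ∈ τ u′ → j ∈ τ v → j′ ∈ τ v′ →
    SimpleEdge u u′ → SimpleEdge v v′ → weight u v ≡ weight u′ v′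
  transport {i} {j} {j′} {u} {u′} {v} {v′} ij ij′ jj′ j′j disj i∈u i∈u′ i∉v i∉v′ j∈u j′∈u′ j∈v j′∈v′ (uu′ , u′u) (vv′ , v′v) =
    ℤ.+-injective (ℤ-Group.∙-cancelˡ (ℤ.- (+ weight u′ v)) _ _ (ℤ-Group.∙-cancelʳ (+ weight u′ v ℤ.* 1ℤ) _ _ (begin
      ℤ.- (+ weight u′ v) ℤ.+ + weight u v ℤ.+ + weight u′ v ℤ.* 1ℤ    ≡⟨ left ⟨
      S j′ (S i (δ v)) u′                                              ≡⟨ braid₂ ij′ u′ v ⟩
      S i (S j′ (δ v)) u′                                              ≡⟨ right ⟩
      ℤ.- (+ weight u′ v) ℤ.+ + weight u′ v′ ℤ.+ + weight u′ v ℤ.* 1ℤ  ∎)))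
    where
    open ≡-Reasoning
    j′∉u : j′ ∉ τ u
    j′∉u j′∈ = disj j′∈ j∈u
    j′∉v : j′ ∉ τ v
    j′∉v j′∈ = disj j′∈ j∈v

    S-δ-off : ∀ {k w} → k ∉ τ w → w ≢ v → S k (δ v) w ≡ 0ℤ
    S-δ-off k∉ w≢v = trans (S-∉ k∉ (δ v)) (δ-diff w≢v)

    -- A path from u′ through w to v survives only for w equal to u or v. If w lacks i, then
    -- `S i (δ v)` is just `δ v` at w; if w has i and j, bonding at u′ applies; if w has i but not
    -- j, compatibility rules out an arrow from w to v.
    supportˡ : ∀ {w} → j′ ∉ τ w → w ≢ u → w ≢ v → weight u′ w ≡ 0 ⊎ S i (δ v) w ≡ 0ℤ
    supportˡ {w} j′∉w w≢u w≢v with toSum (i ∈? τ w)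
    ... | inj₂ i∉w = inj₂ (S-δ-off i∉w w≢v)
    ... | inj₁ i∈w with toSum (j ∈? τ w)
    ...   | inj₁ j∈w = inj₁ (proj₁ (bonding j′j j′∈u′ (disj j′∈u′) j′∉u j∈u j′∉w j∈w (u′u , uu′) w≢u))
    ...   | inj₂ j∉w = inj₂ (trans (S-δ-∉ i∈w i∉v) (cong +_ (compatibility ij i∈w j∉w i∉v j∈v)))

    supportʳ : ∀ {w} → i ∉ τ w → w ≢ v′ → w ≢ v → weight u′ w ≡ 0 ⊎ S j′ (δ v) w ≡ 0ℤ
    supportʳ {w} i∉w w≢v′ w≢v with toSum (j′ ∈? τ w)
    ... | inj₂ j′∉w = inj₂ (S-δ-off j′∉w w≢v)
    ... | inj₁ j′∈w = inj₂ (trans (S-δ-∉ j′∈w j′∉v)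
      (cong +_ (proj₂ (bonding jj′ j∈v j′∉v (disj j′∈v′) j′∈v′ (disj j′∈w) j′∈w (vv′ , v′v) w≢v′))))

    left : S j′ (S i (δ v)) u′ ≡ ℤ.- (+ weight u′ v) ℤ.+ + weight u v ℤ.+ + weight u′ v ℤ.* 1ℤ
    left = trans (S-∈ j′∈u′ (S i (δ v))) (trans (cong₂ ℤ._+_ (cong ℤ.-_ (S-δ-∉ i∈u′ i∉v))
      (trans (Out-two (S i (δ v)) j′∉u j′∉v (≢-sym (∈∉⇒≢ i∈u i∉v)) supportˡ)
        (cong₂ ℤ._+_ (trans (cong₂ ℤ._*_ (cong +_ u′u) (S-δ-∉ i∈u i∉v)) (ℤ.*-identityˡ _))
          (cong (+ weight u′ v ℤ.*_) (trans (S-∉ i∉v (δ v)) (δ-same v))))))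
      (sym (ℤ.+-assoc (ℤ.- (+ weight u′ v)) _ _)))

    right : S i (S j′ (δ v)) u′ ≡ ℤ.- (+ weight u′ v) ℤ.+ + weight u′ v′ ℤ.+ + weight u′ v ℤ.* 1ℤ
    right = trans (S-∈ i∈u′ (S j′ (δ v))) (trans (cong₂ ℤ._+_ (cong ℤ.-_ (S-δ-∉ j′∈u′ j′∉v))
      (trans (Out-two (S j′ (δ v)) i∉v′ i∉v (∈∉⇒≢ j∈v (disj j′∈v′)) supportʳ)
        (cong₂ ℤ._+_ (trans (cong (+ weight u′ v′ ℤ.*_) (trans (S-δ-∉ j′∈v′ j′∉v) (cong +_ v′v))) (ℤ.*-identityʳ (+ weight u′ v′)))
          (cong (+ weight u′ v ℤ.*_) (trans (S-∉ j′∉v (δ v)) (δ-same v))))))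
      (sym (ℤ.+-assoc (ℤ.- (+ weight u′ v)) _ _)))

-- Tableaux as cyclic words

module Cycle {N : ℕ} where

  private n = suc N

  toℕ-next : ∀ (i : Fin n) → toℕ (next i) ≡ suc (toℕ i) % n
  toℕ-next i = Fin.toℕ-fromℕ< (m%n<n (suc (toℕ i)) n)

  -- Addition of m to p modulo n. Recursion through `next p` makes position `suc m` from p and
  -- position `m` from `next p` definitionally equal, on which the rotation of words relies.
  at : Fin n → ℕ → Fin n
  at p zero    = p
  at p (suc m) = at (next p) m

  at-suc : ∀ p m → at p (suc m) ≡ next (at p m)
  at-suc p zero    = refl
  at-suc p (suc m) = at-suc (next p) m

  at-+ : ∀ p k l → at p (k + l) ≡ at (at p k) l
  at-+ p zero    l = refl
  at-+ p (suc k) l = at-+ (next p) k l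

  toℕ-at : ∀ p m → toℕ (at p m) ≡ (toℕ p + m) % n
  toℕ-at p zero    = sym (trans (cong (_% n) (ℕ.+-identityʳ (toℕ p))) (m<n⇒m%n≡m (Fin.toℕ<n p)))
  toℕ-at p (suc m) = begin
    toℕ (at (next p) m)              ≡⟨ toℕ-at (next p) m ⟩
    (toℕ (next p) + m) % n           ≡⟨ cong (λ x → (x + m) % n) (toℕ-next p) ⟩
    (suc (toℕ p) % n + m) % n        ≡⟨ %-absorbˡ (suc (toℕ p)) m ⟩
    (suc (toℕ p) + m) % n            ≡⟨ cong (_% n) (ℕ.+-suc (toℕ p) m) ⟨
    (toℕ p + suc m) % n              ∎
    where
    open ≡-Reasoning
    %-absorbˡ : ∀ x y → (x % n + y) % n ≡ (x + y) % n
    %-absorbˡ x y = trans (%-distribˡ-+ (x % n) y n)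
      (trans (cong (λ z → (z + y % n) % n) (m<n⇒m%n≡m (m%n<n x n))) (sym (%-distribˡ-+ x y n)))

  at-period : ∀ p → at p n ≡ p
  at-period p = Fin.toℕ-injective
    (trans (toℕ-at p n) (trans ([m+n]%n≡m%n (toℕ p) n) (m<n⇒m%n≡m (Fin.toℕ<n p))))

  -- Without wrap-around, p + d = p gives d = 0. With wrap-around, p + d - n = p would give d = n,
  -- against the bound on d.
  at-fixed : ∀ p {d} → d ℕ.< n → at p d ≡ p → d ≡ 0
  at-fixed p {d} d<n eq with toℕ p + d ℕ.<? n
  ... | yes lt = ℕ.+-cancelˡ-≡ (toℕ p) d 0 (trans (sym (m<n⇒m%n≡m lt))
                   (trans (sym (toℕ-at p d)) (trans (cong toℕ eq) (sym (ℕ.+-identityʳ _)))))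
  ... | no ≮ = contradiction (ℕ.+-cancelˡ-≡ (toℕ p) d n (trans (sym (ℕ.m∸n+n≡m n≤p+d)) (cong (_+ n) r≡p))) (ℕ.<⇒≢ d<n)
    where
    n≤p+d = ℕ.≮⇒≥ ≮
    r = toℕ p + d ∸ n
    r<n : r ℕ.< n
    r<n = ℕ.+-cancelʳ-< n r n (subst (ℕ._< n + n) (sym (ℕ.m∸n+n≡m n≤p+d)) (ℕ.+-mono-< (Fin.toℕ<n p) d<n))
    r≡p : r ≡ toℕ p
    r≡p = begin
      r                ≡⟨ m<n⇒m%n≡m r<n ⟨
      r % n            ≡⟨ [m+n]%n≡m%n r n ⟨
      (r + n) % n      ≡⟨ cong (_% n) (ℕ.m∸n+n≡m n≤p+d) ⟩
      (toℕ p + d) % n  ≡⟨ toℕ-at p d ⟨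
      toℕ (at p d)     ≡⟨ cong toℕ eq ⟩
      toℕ p            ∎
      where open ≡-Reasoning

  at-injective-≤ : ∀ p {k l} → k ≤ l → l ℕ.< n → at p l ≡ at p k → k ≡ l
  at-injective-≤ p {k} {l} k≤l l<n eq = sym (trans (sym k+d≡l) (trans (cong (ℕ._+_ k) d≡0) (ℕ.+-identityʳ k)))
    where
    k+d≡l : k + (l ∸ k) ≡ l
    k+d≡l = ℕ.m+[n∸m]≡n k≤l
    d≡0 : l ∸ k ≡ 0
    d≡0 = at-fixed (at p k) (ℕ.≤-<-trans (ℕ.m∸n≤m l k) l<n)
      (trans (sym (at-+ p k (l ∸ k))) (trans (cong (at p) k+d≡l) eq))

  at-injective : ∀ p {k l} → k ℕ.< n → l ℕ.< n → at p k ≡ at p l → k ≡ l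
  at-injective p {k} {l} k<n l<n eq with ℕ.≤-total k l
  ... | inj₁ k≤l = at-injective-≤ p k≤l l<n (sym eq)
  ... | inj₂ l≤k = sym (at-injective-≤ p l≤k k<n eq)

  at-surjective : ∀ p k → ∃[ m ] m ℕ.< n × at p m ≡ k
  at-surjective p k = m , m%n<n x n , Fin.toℕ-injective (begin
    toℕ (at p m)             ≡⟨ toℕ-at p m ⟩
    (toℕ p + x % n) % n      ≡⟨ %-absorbʳ (toℕ p) x ⟩
    (toℕ p + x) % n          ≡⟨ cong (_% n) p+x ⟩
    (toℕ k + n) % n          ≡⟨ [m+n]%n≡m%n (toℕ k) n ⟩
    toℕ k % n                ≡⟨ m<n⇒m%n≡m (Fin.toℕ<n k) ⟩
    toℕ k                    ∎)
    where
    open ≡-Reasoning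
    -- The difference k - p modulo n, with n added so that the truncated subtraction is exact.
    x = toℕ k + (n ∸ toℕ p)
    m = x % n
    %-absorbʳ : ∀ x y → (x + y % n) % n ≡ (x + y) % n
    %-absorbʳ x y = trans (%-distribˡ-+ x (y % n) n)
      (trans (cong (λ z → (x % n + z) % n) (m<n⇒m%n≡m (m%n<n y n))) (sym (%-distribˡ-+ x y n)))
    p+x : toℕ p + x ≡ toℕ k + n
    p+x = begin
      toℕ p + (toℕ k + (n ∸ toℕ p))   ≡⟨ ℕ.+-comm (toℕ p) _ ⟩
      toℕ k + (n ∸ toℕ p) + toℕ p     ≡⟨ ℕ.+-assoc (toℕ k) _ _ ⟩
      toℕ k + (n ∸ toℕ p + toℕ p)     ≡⟨ cong (ℕ._+_ (toℕ k)) (ℕ.m∸n+n≡m (ℕ.<⇒≤ (Fin.toℕ<n p))) ⟩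
      toℕ k + n                       ∎

does-true : ∀ {P : Set} (d : Dec P) → does d ≡ true → P
does-true (yes p) _ = p

data Letter : Set where
  U D : Letter

U≢D : U ≢ D
U≢D ()

toLetter : ℕ → Letter
toLetter zero    = U
toLetter (suc _) = D

letter : ∀ {μ} → RSYT μ → Fin (sum μ) → Letter
letter T k = toLetter (rowIndex (RSYT.rows T) k)

module _ {n : ℕ} where

  open DecMembership (Fin._≟_ {n}) using () renaming (_∈?_ to _∈ˡ?_)

  rowIndex-bound : ∀ rs {k : Fin n} → k ∈ˡ concat rs → rowIndex rs k ℕ.< length rs
  rowIndex-bound (r ∷ rs) {k} k∈ with k ∈ˡ? r
  ... | yes _  = s≤s z≤n
  ... | no  k∉ with Mem.∈-++⁻ r k∈
  ...   | inj₁ k∈r  = contradiction k∈r k∉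
  ...   | inj₂ k∈rs = s≤s (rowIndex-bound rs k∈rs)

  open InsertionSort (Fin.≤-decTotalOrder n) using (sort)
  open InsertionSortₚ (Fin.≤-decTotalOrder n) using (sort-↭)

  ∈-interchanged : ∀ i r (k : Fin n) → k ∈ˡ sort (map (swapLabels i) r) ⇔ swapLabels i k ∈ˡ r
  ∈-interchanged i r k = mk⇔ to from
    where
    open InterchangeProperties i using (swap-involutive)
    to : k ∈ˡ sort (map (swapLabels i) r) → swapLabels i k ∈ˡ r
    to k∈ with Mem.∈-map⁻ (swapLabels i) (↭.∈-resp-↭ (sort-↭ _) k∈)
    ... | x , x∈ , refl = subst (_∈ˡ r) (sym (swap-involutive x)) x∈
    from : swapLabels i k ∈ˡ r → k ∈ˡ sort (map (swapLabels i) r)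
    from k∈ = ↭.∈-resp-↭ (↭-sym (sort-↭ _))
      (subst (_∈ˡ map (swapLabels i) r) (swap-involutive k) (Mem.∈-map⁺ (swapLabels i) k∈))

  rowIndex-interchange : ∀ i rs (k : Fin n) → rowIndex (interchangeRows i rs) k ≡ rowIndex rs (swapLabels i k)
  rowIndex-interchange i []       k = refl
  rowIndex-interchange i (r ∷ rs) k
    rewrite does-⇔ (∈-interchanged i r k) (k ∈ˡ? sort (map (swapLabels i) r)) (swapLabels i k ∈ˡ? r)
          | rowIndex-interchange i rs k = refl

  unique-disjoint : ∀ (xs {ys} : List (Fin n)) {k} → Unique (xs ++ ys) → k ∈ˡ xs → ¬ k ∈ˡ ys
  unique-disjoint (x ∷ xs) (x≢ ∷ _) (here refl) k∈ys = All.lookup x≢ (Mem.∈-++⁺ʳ xs k∈ys) refl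
  unique-disjoint (x ∷ xs) (_ ∷ u)  (there k∈)  k∈ys = unique-disjoint xs u k∈ k∈ys

  Linked⇒Unique : ∀ {xs : List (Fin n)} → Linked _<_ xs → Unique xs
  Linked⇒Unique l = AllPairs.map Fin.<⇒≢ (Linked.Linked⇒AllPairs Fin.<-trans l)

  unique-↭ : ∀ {xs ys : List (Fin n)} → Unique xs → Unique ys → (∀ k → k ∈ˡ xs ⇔ k ∈ˡ ys) → xs ↭ ys
  unique-↭ u v p = ∼bag⇒↭ (unique∧set⇒bag u v (λ {k} → p k))

  sorted-≡ : ∀ {xs ys : List (Fin n)} → Linked _<_ xs → Linked _<_ ys → (∀ k → k ∈ˡ xs ⇔ k ∈ˡ ys) → xs ≡ ys
  sorted-≡ l l′ p = Pointwise.Pointwise-≡⇒≡ (Sorted.↗↭↗⇒≋ (Fin.≤-totalOrder n)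
    (Linked.map ℕ.<⇒≤ l) (Linked.map ℕ.<⇒≤ l′) (↭⇒↭ₛ (unique-↭ (Linked⇒Unique l) (Linked⇒Unique l′) p)))

  unique? : (xs : List (Fin n)) → Dec (Unique xs)
  unique? = AllPairs.allPairs? (λ x y → ¬? (x Fin.≟ y))

  exhaustive? : (xs : List (Fin n)) → Dec (∀ k → k ∈ˡ xs)
  exhaustive? xs = Fin.all? (_∈ˡ? xs)

upWeight downWeight : Letter → ℕ
upWeight U = 1
upWeight D = 0
downWeight U = 0
downWeight D = 1

total : (Letter → ℕ) → List Letter → ℕ
total w xs = sum (map w xs)

total-constant : ∀ {A : Set} w {x} (f : A → Letter) {xs} → All (λ k → f k ≡ x) xs →
  total w (map f xs) ≡ length xs * w x
total-constant w f []                = refl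
total-constant w f (_∷_ {x = k} p ps) = cong₂ _+_ (cong w p) (total-constant w f ps)

module _ {A : Set} where

  applyUpTo-cong : ∀ n {f g : ℕ → A} → (∀ {m} → m ℕ.< n → f m ≡ g m) → applyUpTo f n ≡ applyUpTo g n
  applyUpTo-cong zero    p = refl
  applyUpTo-cong (suc n) p = cong₂ _∷_ (p (s≤s z≤n)) (applyUpTo-cong n (p ∘ s≤s))

  applyUpTo-injective : ∀ n {f g : ℕ → A} {m} → applyUpTo f n ≡ applyUpTo g n → m ℕ.< n → f m ≡ g m
  applyUpTo-injective (suc n) {m = zero}  eq _         = List.∷-injectiveˡ eq
  applyUpTo-injective (suc n) {m = suc m} eq (s≤s m<n) = applyUpTo-injective n (List.∷-injectiveʳ eq) m<n

  applyUpTo-read : ∀ n {f : ℕ → A} xs {y ys} → applyUpTo f n ≡ xs ++ y ∷ ys → f (length xs) ≡ y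
  applyUpTo-read zero    []       ()
  applyUpTo-read zero    (_ ∷ _)  ()
  applyUpTo-read (suc n) []       eq = List.∷-injectiveˡ eq
  applyUpTo-read (suc n) (_ ∷ xs) eq = applyUpTo-read n xs (List.∷-injectiveʳ eq)

  applyUpTo-read₁ : ∀ n {f : ℕ → A} xs {x y ys} → applyUpTo f n ≡ xs ++ x ∷ y ∷ ys → f (1 + length xs) ≡ y
  applyUpTo-read₁ zero    []       ()
  applyUpTo-read₁ zero    (_ ∷ _)  ()
  applyUpTo-read₁ (suc n) []       eq = applyUpTo-read n [] (List.∷-injectiveʳ eq)
  applyUpTo-read₁ (suc n) (_ ∷ xs) eq = applyUpTo-read₁ n xs (List.∷-injectiveʳ eq)

  applyUpTo-read₂ : ∀ n {f : ℕ → A} xs {x y z ys} → applyUpTo f n ≡ xs ++ x ∷ y ∷ z ∷ ys → f (2 + length xs) ≡ z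
  applyUpTo-read₂ zero    []       ()
  applyUpTo-read₂ zero    (_ ∷ _)  ()
  applyUpTo-read₂ (suc n) []       eq = applyUpTo-read₁ n [] (List.∷-injectiveʳ eq)
  applyUpTo-read₂ (suc n) (_ ∷ xs) eq = applyUpTo-read₂ n xs (List.∷-injectiveʳ eq)

  applyUpTo-splice : ∀ n {f g : ℕ → A} xs {x y z x′ y′ z′ ys} → applyUpTo f n ≡ xs ++ x ∷ y ∷ z ∷ ys →
    g (length xs) ≡ x′ → g (1 + length xs) ≡ y′ → g (2 + length xs) ≡ z′ →
    (∀ {m} → m ℕ.< n → m ≢ length xs → m ≢ 1 + length xs → m ≢ 2 + length xs → g m ≡ f m) →
    applyUpTo g n ≡ xs ++ x′ ∷ y′ ∷ z′ ∷ ys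
  applyUpTo-splice zero [] ()
  applyUpTo-splice zero (_ ∷ _) ()
  applyUpTo-splice (suc zero) [] ()
  applyUpTo-splice (suc (suc zero)) [] ()
  applyUpTo-splice (suc (suc (suc n))) [] refl refl refl refl same =
    cong (λ ys → _ ∷ _ ∷ _ ∷ ys) (applyUpTo-cong n (λ m<n → same (s≤s (s≤s (s≤s m<n))) (λ ()) (λ ()) λ ()))
  applyUpTo-splice (suc n) {f} {g} (w ∷ xs) eq p q r same = cong₂ _∷_
    (trans (same (s≤s z≤n) (λ ()) (λ ()) λ ()) (List.∷-injectiveˡ eq))
    (applyUpTo-splice n xs (List.∷-injectiveʳ eq) p q r
      (λ m<n u v w → same (s≤s m<n) (u ∘ ℕ.suc-injective) (v ∘ ℕ.suc-injective) (w ∘ ℕ.suc-injective)))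

module TwoRows (c : ℕ) where

  a n : ℕ
  μ : List ℕ
  a = suc (suc c)
  μ = a ∷ a ∷ []
  n = sum μ

  Tab : Set
  Tab = RSYT μ

  open Cycle

  reading : Fin n → Tab → ℕ → Letter
  reading p T m = letter T (at p m)

  word : Fin n → Tab → List Letter
  word p T = applyUpTo (reading p T) n

  -- The proofs stored in a tableau are irrelevant; this and the next three properties are recovered
  -- by deciding them.
  shaped : (T : Tab) → map length (RSYT.rows T) ≡ μ
  shaped (mkRSYT _ s _ _ _) = recompute (List.≡-dec ℕ._≟_ _ _) s

  distinct : (T : Tab) → Unique (concat (RSYT.rows T))
  distinct (mkRSYT _ _ d _ _) = recompute (unique? _) d

  exhausts : (T : Tab) → ∀ k → k ∈ˡ concat (RSYT.rows T)
  exhausts (mkRSYT _ _ _ e _) = recompute (exhaustive? _) e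

  increasing : (T : Tab) → All (Linked _<_) (RSYT.rows T)
  increasing (mkRSYT _ _ _ _ l) = recompute (All.all? (Linked.linked? Fin._<?_) _) l

  module _ (T : Tab) where

    rowIndex-≤1 : ∀ k → rowIndex (RSYT.rows T) k ≤ 1
    rowIndex-≤1 k = ℕ.≤-pred (subst (rowIndex (RSYT.rows T) k ℕ.<_)
      (trans (sym (List.length-map length (RSYT.rows T))) (cong length (shaped T)))
      (rowIndex-bound (RSYT.rows T) (exhausts T k)))

    isDescent : Fin n → Bool
    isDescent i = does (rowIndex (RSYT.rows T) i ℕ.<? rowIndex (RSYT.rows T) (next i))

    des⁺ : ∀ i → letter T i ≡ U → letter T (next i) ≡ D → i ∈ des T
    des⁺ i up down = Vec.lookup⇒[]= i (des T) (trans (Vec.lookup∘tabulate isDescent i) (dec-true (rowIndex (RSYT.rows T) i ℕ.<? _) lt))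
      where
      lt : rowIndex (RSYT.rows T) i ℕ.< rowIndex (RSYT.rows T) (next i)
      lt with rowIndex (RSYT.rows T) i | rowIndex (RSYT.rows T) (next i)
      lt | zero | suc _ = s≤s z≤n

    des⁻ : ∀ i → i ∈ des T → letter T i ≡ U × letter T (next i) ≡ D
    des⁻ i i∈ = letters (rowIndex (RSYT.rows T) i) _ lt (rowIndex-≤1 (next i))
      where
      letters : ∀ x y → x ℕ.< y → y ≤ 1 → toLetter x ≡ U × toLetter y ≡ D
      letters zero    (suc _) _       _         = refl , refl
      letters (suc x) (suc y) (s≤s lt) (s≤s z≤n) = contradiction lt λ ()
      lt : rowIndex (RSYT.rows T) i ℕ.< rowIndex (RSYT.rows T) (next i)
      lt = does-true (rowIndex (RSYT.rows T) i ℕ.<? _) (trans (sym (Vec.lookup∘tabulate isDescent i)) (Vec.[]=⇒lookup i∈))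

  interchange-letter : ∀ i (T : Tab) k → letter (interchange i T) k ≡ letter T (swapLabels i k)
  interchange-letter i (mkRSYT rs _ _ _ _) k = cong toLetter (rowIndex-interchange i rs k)

  interchange-here : ∀ i (T : Tab) → letter (interchange i T) i ≡ letter T (next i)
  interchange-here i T = trans (interchange-letter i T i) (cong (letter T) swapped)
    where
    swapped : swapLabels i i ≡ next i
    swapped rewrite dec-true (i Fin.≟ i) refl = refl

  interchange-next : ∀ i (T : Tab) → letter (interchange i T) (next i) ≡ letter T i
  interchange-next i T = trans (interchange-letter i T (next i)) (cong (letter T) swapped)
    where
    swapped : swapLabels i (next i) ≡ i
    swapped with next i Fin.≟ i
    ... | yes eq = eq
    ... | no  _ rewrite dec-true (next i Fin.≟ next i) refl = refl

  interchange-other : ∀ i (T : Tab) {k} → k ≢ i → k ≢ next i → letter (interchange i T) k ≡ letter T k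
  interchange-other i T {k} k≢i k≢j = trans (interchange-letter i T k) (cong (letter T) swapped)
    where
    swapped : swapLabels i k ≡ k
    swapped rewrite dec-false (k Fin.≟ i) k≢i | dec-false (k Fin.≟ next i) k≢j = refl

  -- The move from UDx to xUD on the positions j, j + 1, j + 2, oriented so that the descent j of
  -- `T` becomes the descent j + 1 of `T′`.
  record Cup (j : Fin n) (T T′ : Tab) : Set where
    field
      knuth  : KnuthMove T T′
      up     : letter T j ≡ U
      down   : letter T (next j) ≡ D
      up′    : letter T′ (next j) ≡ U
      down′  : letter T′ (next (next j)) ≡ D
      pushed : letter T′ j ≡ letter T (next (next j))
      same   : ∀ {k} → k ≢ j → k ≢ next j → k ≢ next (next j) → letter T′ k ≡ letter T k

  at-≢ : ∀ p {k l} → k ℕ.< n → l ℕ.< n → k ≢ l → at p k ≢ at p l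
  at-≢ p k<n l<n k≢l eq = k≢l (at-injective p k<n l<n eq)

  1<n : 1 ℕ.< n
  1<n = s≤s (s≤s z≤n)

  2<n : 2 ℕ.< n
  2<n = s≤s (s≤s (subst (1 ≤_) (sym (ℕ.+-suc c _)) (s≤s z≤n)))

  i≢next : ∀ (i : Fin n) → i ≢ next i
  i≢next i = at-≢ i (s≤s z≤n) 1<n λ ()

  i≢next² : ∀ (i : Fin n) → i ≢ next (next i)
  i≢next² i = at-≢ i (s≤s z≤n) 2<n λ ()

  -- The descent sets are incomparable because i is a descent of `T` only and `next i` a descent of
  -- `T′` only.
  knuthMove : ∀ T T′ i → letter T i ≡ U → letter T (next i) ≡ D →
    letter T′ (next i) ≡ U → letter T′ (next (next i)) ≡ D → (∃[ k ] T′ ≡ interchange k T) → KnuthMove T T′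
  knuthMove T T′ i up down up′ down′ e =
    ( (λ T⊆ → U≢D (trans (sym up′) (proj₂ (des⁻ T′ i (T⊆ (des⁺ T i up down))))))
    , (λ T⊇ → U≢D (trans (sym (proj₁ (des⁻ T (next i) (T⊇ (des⁺ T′ (next i) up′ down′))))) down))) , e

  -- The third letter selects the transposition: UDD becomes DUD by interchanging j and j + 1, and
  -- UDU becomes UUD by interchanging j + 1 and j + 2.
  slideRight : ∀ j T → letter T j ≡ U → letter T (next j) ≡ D → ∃[ T′ ] Cup j T T′
  slideRight j T up down with letter T (next (next j)) in third
  ... | D = T′ , record
    { knuth = knuthMove T T′ j up down up′ down′ (j , refl)
    ; up = up ; down = down ; up′ = up′ ; down′ = down′
    ; pushed = trans (interchange-here j T) (trans down (sym third))
    ; same = λ k≢ k≢′ _ → interchange-other j T k≢ k≢′ }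
    where
    T′ = interchange j T
    up′ : letter T′ (next j) ≡ U
    up′ = trans (interchange-next j T) up
    down′ : letter T′ (next (next j)) ≡ D
    down′ = trans (interchange-other j T (≢-sym (i≢next² j)) (≢-sym (i≢next (next j)))) third
  ... | U = T′ , record
    { knuth = knuthMove T T′ j up down up′ down′ (next j , refl)
    ; up = up ; down = down ; up′ = up′ ; down′ = down′
    ; pushed = trans (interchange-other (next j) T (i≢next j) (i≢next² j)) (trans up (sym third))
    ; same = λ _ k≢ k≢′ → interchange-other (next j) T k≢ k≢′ }
    where
    T′ = interchange (next j) T
    up′ : letter T′ (next j) ≡ U
    up′ = trans (interchange-here (next j) T) third
    down′ : letter T′ (next (next j)) ≡ D
    down′ = trans (interchange-next (next j) T) down

  slideLeft : ∀ j T → letter T (next j) ≡ U → letter T (next (next j)) ≡ D → ∃[ T′ ] Cup j T′ T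
  slideLeft j T up′ down′ with letter T j in first
  ... | D = T′ , record
    { knuth = knuthMove T′ T j up down up′ down′ (j , sym (interchange-involutive j T))
    ; up = up ; down = down ; up′ = up′ ; down′ = down′
    ; pushed = trans first (sym (trans (interchange-other j T (≢-sym (i≢next² j)) (≢-sym (i≢next (next j)))) down′))
    ; same = λ k≢ k≢′ _ → sym (interchange-other j T k≢ k≢′) }
    where
    T′ = interchange j T
    up : letter T′ j ≡ U
    up = trans (interchange-here j T) up′
    down : letter T′ (next j) ≡ D
    down = trans (interchange-next j T) first
  ... | U = T′ , record
    { knuth = knuthMove T′ T j up down up′ down′ (next j , sym (interchange-involutive (next j) T))
    ; up = up ; down = down ; up′ = up′ ; down′ = down′
    ; pushed = trans first (sym (trans (interchange-next (next j) T) up′))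
    ; same = λ _ k≢ k≢′ → sym (interchange-other (next j) T k≢ k≢′) }
    where
    T′ = interchange (next j) T
    up : letter T′ j ≡ U
    up = trans (interchange-other (next j) T (i≢next j) (i≢next² j)) first
    down : letter T′ (next j) ≡ D
    down = trans (interchange-here (next j) T) down′

  -- The positions of U form the top row and their complement the bottom row; increasing rows are
  -- determined by their sets of entries.
  letters-injective : ∀ {T T′} → (∀ k → letter T k ≡ letter T′ k) → T ≡ T′
  letters-injective {T} {T′} same = rows-injective T T′
    (rows-≡ (RSYT.rows T) (RSYT.rows T′) (shaped T) (shaped T′) (distinct T) (distinct T′)
      (exhausts T) (exhausts T′) (increasing T) (increasing T′) same)
    where
    open DecMembership (Fin._≟_ {n}) using () renaming (_∈?_ to _∈ˡ?_)

    top : ∀ {r s : List (Fin n)} {k} → k ∈ˡ r ⇔ toLetter (rowIndex (r ∷ s ∷ []) k) ≡ U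
    top {r} {s} {k} with k ∈ˡ? r
    ... | yes k∈ = mk⇔ (λ _ → refl) (λ _ → k∈)
    ... | no  k∉ = mk⇔ (λ k∈ → contradiction k∈ k∉) λ ()

    bottom : ∀ {r s : List (Fin n)} {k} → Unique (r ++ s ++ []) → k ∈ˡ r ++ s ++ [] →
      k ∈ˡ s ⇔ (¬ k ∈ˡ r)
    bottom {r} {s} {k} u k∈ = mk⇔ to from
      where
      to : k ∈ˡ s → ¬ k ∈ˡ r
      to k∈s k∈r = unique-disjoint r (subst (λ t → Unique (r ++ t)) (List.++-identityʳ s) u) k∈r k∈s
      from : ¬ k ∈ˡ r → k ∈ˡ s
      from k∉ with Mem.∈-++⁻ r k∈
      ... | inj₁ k∈r = contradiction k∈r k∉
      ... | inj₂ k∈s = subst (k ∈ˡ_) (List.++-identityʳ s) k∈s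

    rows-≡ : ∀ rs rs′ → map length rs ≡ μ → map length rs′ ≡ μ → Unique (concat rs) → Unique (concat rs′) →
      (∀ k → k ∈ˡ concat rs) → (∀ k → k ∈ˡ concat rs′) → All (Linked _<_) rs → All (Linked _<_) rs′ →
      (∀ k → toLetter (rowIndex rs k) ≡ toLetter (rowIndex rs′ k)) → rs ≡ rs′
    rows-≡ (r ∷ s ∷ []) (r′ ∷ s′ ∷ []) _ _ u u′ e e′ (l ∷ k ∷ []) (l′ ∷ k′ ∷ []) same =
      cong₂ (λ x y → x ∷ y ∷ []) (sorted-≡ l l′ same-top)
        (sorted-≡ k k′ (λ k → ⇔-sym (bottom u′ (e′ k)) ⇔-∘ (¬-cong-⇔ (same-top k) ⇔-∘ bottom u (e k))))
      where
      same-top : ∀ k → k ∈ˡ r ⇔ k ∈ˡ r′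
      same-top k = ⇔-sym (top {r′} {s′}) ⇔-∘ (mk⇔ (trans (sym (same k))) (trans (same k)) ⇔-∘ top {r} {s})

  word-injective : ∀ p {T T′} → word p T ≡ word p T′ → T ≡ T′
  word-injective p {T} {T′} eq = letters-injective λ k → helper k (at-surjective p k)
    where
    helper : ∀ k → ∃[ m ] m ℕ.< n × at p m ≡ k → letter T k ≡ letter T′ k
    helper k (m , m<n , refl) = applyUpTo-injective n {reading p T} {reading p T′} eq m<n

  rotate : ∀ p T {x xs} → word p T ≡ x ∷ xs → word (next p) T ≡ xs ++ x ∷ []
  rotate p T {x} {xs} eq = trans (sym (List.applyUpTo-∷ʳ (reading (next p) T) _))
    (cong₂ (λ ys y → ys ++ y ∷ []) (List.∷-injectiveʳ eq)
      (trans (cong (letter T) (at-period p)) (List.∷-injectiveˡ eq)))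

  -- The n positions read from p are a rearrangement of the concatenated rows, where the letters are
  -- a times U followed by a times D. A general weight `w` yields the counts of both letters.
  total-word : ∀ w p T → total w (word p T) ≡ a * w U + a * w D
  total-word w p T = begin
    total w (word p T)                                  ≡⟨ cong (total w) (List.map-applyUpTo (at p) (letter T) n) ⟨
    total w (map (letter T) (applyUpTo (at p) n))       ≡⟨ Sum.sum-↭ (↭.map⁺ w (↭.map⁺ (letter T) positions)) ⟩
    total w (map (letter T) (concat (RSYT.rows T)))     ≡⟨ by-rows (RSYT.rows T) (shaped T) (distinct T) ⟩
    a * w U + a * w D                                   ∎
    where
    open ≡-Reasoning
    positions : applyUpTo (at p) n ↭ concat (RSYT.rows T)
    positions = unique-↭
      (Unique.applyUpTo⁺₁ (at p) n (λ i<j j<n → at-≢ p (ℕ.<-trans i<j j<n) j<n (ℕ.<⇒≢ i<j)))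
      (distinct T) (λ k → mk⇔ (λ _ → exhausts T k) (λ _ → present k (at-surjective p k)))
      where
      present : ∀ k → ∃[ m ] m ℕ.< n × at p m ≡ k → k ∈ˡ applyUpTo (at p) n
      present k (m , m<n , refl) = Mem.∈-applyUpTo⁺ (at p) m<n

    by-rows : ∀ rs → map length rs ≡ μ → Unique (concat rs) →
      total w (map (λ k → toLetter (rowIndex rs k)) (concat rs)) ≡ a * w U + a * w D
    by-rows (r ∷ s ∷ []) eq u = begin
      total w (map f (r ++ s ++ []))                   ≡⟨ cong (total w ∘ map f ∘ (r ++_)) (List.++-identityʳ s) ⟩
      total w (map f (r ++ s))                         ≡⟨ cong (total w) (List.map-++ f r s) ⟩
      total w (map f r ++ map f s)                     ≡⟨ cong sum (List.map-++ w (map f r) (map f s)) ⟩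
      sum (map w (map f r) ++ map w (map f s))         ≡⟨ Sum.sum-++ (map w (map f r)) _ ⟩
      total w (map f r) + total w (map f s)            ≡⟨ cong₂ _+_ (total-constant w f (All.tabulate top)) (total-constant w f (All.tabulate bottom)) ⟩
      length r * w U + length s * w D                  ≡⟨ cong₂ (λ k l → k * w U + l * w D) (List.∷-injectiveˡ eq) (List.∷-injectiveˡ (List.∷-injectiveʳ eq)) ⟩
      a * w U + a * w D                                ∎
      where
      open DecMembership (Fin._≟_ {n}) using () renaming (_∈?_ to _∈ˡ?_)
      f : Fin n → Letter
      f k = toLetter (rowIndex (r ∷ s ∷ []) k)
      top : ∀ {k} → k ∈ˡ r → f k ≡ U
      top {k} k∈ rewrite dec-true (k ∈ˡ? r) k∈ = refl
      bottom : ∀ {k} → k ∈ˡ s → f k ≡ D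
      bottom {k} k∈ rewrite dec-false (k ∈ˡ? r) (λ k∈r → unique-disjoint r (subst (λ t → Unique (r ++ t)) (List.++-identityʳ s) u) k∈r k∈) = refl

  at-read : ∀ p T xs {y ys} → word p T ≡ xs ++ y ∷ ys → letter T (at p (length xs)) ≡ y
  at-read p T xs eq = applyUpTo-read n {reading p T} xs eq

  next-at : ∀ (p : Fin n) m → next (at p m) ≡ at p (suc m)
  next-at p m = sym (at-suc p m)

  window : ∀ p T xs {ys} → word p T ≡ xs ++ ys → length xs + length ys ≡ n
  window p T xs {ys} eq = trans (sym (List.length-++ xs)) (trans (cong length (sym eq)) (List.length-applyUpTo (reading p T) n))

  private
    module Slide (p : Fin n) (xs : List Letter) where
      k = length xs
      j = at p k

      next-j : next j ≡ at p (1 + k)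
      next-j = next-at p k

      next²-j : next (next j) ≡ at p (2 + k)
      next²-j = trans (cong next next-j) (next-at p (1 + k))

      third : ∀ T {x y z ys} → word p T ≡ xs ++ x ∷ y ∷ z ∷ ys →
        letter T j ≡ x × letter T (next j) ≡ y × letter T (next (next j)) ≡ z
      third T {x} {y} {z} {ys} eq = at-read p T xs eq
        , trans (cong (letter T) next-j) (applyUpTo-read₁ n {reading p T} xs eq)
        , trans (cong (letter T) next²-j) (applyUpTo-read₂ n {reading p T} xs eq)

      fits : ∀ T {x y z ys} → word p T ≡ xs ++ x ∷ y ∷ z ∷ ys → 3 + k ≤ n
      fits T {ys = ys} eq = subst₂ _≤_ (ℕ.+-comm k 3) (window p T xs eq) (ℕ.+-monoʳ-≤ k (s≤s (s≤s (s≤s z≤n))))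

      elsewhere : 3 + k ≤ n → ∀ {m} → m ℕ.< n → m ≢ k → m ≢ 1 + k → m ≢ 2 + k →
        at p m ≢ j × at p m ≢ next j × at p m ≢ next (next j)
      elsewhere f m<n m≢ m≢′ m≢″ =
          at-≢ p m<n (ℕ.≤-trans (ℕ.m≤n+m _ 2) f) m≢
        , (λ e → at-≢ p m<n (ℕ.≤-trans (ℕ.m≤n+m _ 1) f) m≢′ (trans e next-j))
        , (λ e → at-≢ p m<n f m≢″ (trans e next²-j))

  slideRight-word : ∀ p T xs {z ys} → word p T ≡ xs ++ U ∷ D ∷ z ∷ ys →
    ∃[ T′ ] Cup (at p (length xs)) T T′ × word p T′ ≡ xs ++ z ∷ U ∷ D ∷ ys
  slideRight-word p T xs {z} {ys} eq with third T eq
    where open Slide p xs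
  ... | x , y , z with slideRight (at p (length xs)) T x y
  ...   | T′ , cup = T′ , cup , applyUpTo-splice n xs eq
      (trans pushed z) (trans (cong (letter T′) (sym next-j)) up′) (trans (cong (letter T′) (sym next²-j)) down′)
      λ m<n m≢ m≢′ m≢″ → let o , o′ , o″ = elsewhere (fits T eq) m<n m≢ m≢′ m≢″ in same o o′ o″
    where
    open Slide p xs
    open Cup cup

  slideLeft-word : ∀ p T xs {z ys} → word p T ≡ xs ++ z ∷ U ∷ D ∷ ys →
    ∃[ T′ ] Cup (at p (length xs)) T′ T × word p T′ ≡ xs ++ U ∷ D ∷ z ∷ ys
  slideLeft-word p T xs {z} {ys} eq with third T eq
    where open Slide p xs
  ... | x , y , z with slideLeft (at p (length xs)) T y z
  ...   | T′ , cup = T′ , cup , applyUpTo-splice n xs eq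
      up (trans (cong (letter T′) (sym next-j)) down) (trans (cong (letter T′) (sym next²-j)) (trans (sym pushed) x))
      λ m<n m≢ m≢′ m≢″ → let o , o′ , o″ = elsewhere (fits T eq) m<n m≢ m≢′ m≢″ in sym (same o o′ o″)
    where
    open Slide p xs
    open Cup cup

  slide-fits : ∀ p T xs {x y z ys} → word p T ≡ xs ++ x ∷ y ∷ z ∷ ys → 3 + length xs ≤ n
  slide-fits p T xs = Slide.fits p xs T

-- Sliding cups

infix 4 _⇉_ _∼_

data _⇉_ : List Letter → List Letter → Set where
  slide : ∀ xs z ys → (xs ++ U ∷ D ∷ z ∷ ys) ⇉ (xs ++ z ∷ U ∷ D ∷ ys)

-- This is the plactic congruence on two letters: the word UD is made central.
_∼_ : List Letter → List Letter → Set
_∼_ = EqClosure _⇉_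

∼-sym : ∀ {xs ys} → xs ∼ ys → ys ∼ xs
∼-sym = Eq.symmetric _⇉_

∷-cong : ∀ x {ys zs} → ys ∼ zs → x ∷ ys ∼ x ∷ zs
∷-cong x = Eq.gmap (x ∷_) λ { (slide xs z ys) → slide (x ∷ xs) z ys }

cups : ℕ → List Letter → List Letter
cups zero    zs = zs
cups (suc k) zs = U ∷ D ∷ cups k zs

cups-cong : ∀ k {ys zs} → ys ∼ zs → cups k ys ∼ cups k zs
cups-cong zero    p = p
cups-cong (suc k) p = ∷-cong U (∷-cong D (cups-cong k p))

cups-++ : ∀ k zs ws → cups k zs ++ ws ≡ cups k (zs ++ ws)
cups-++ zero    zs ws = refl
cups-++ (suc k) zs ws = cong (λ xs → U ∷ D ∷ xs) (cups-++ k zs ws)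

cups-+ : ∀ k l zs → cups k (cups l zs) ≡ cups (k + l) zs
cups-+ zero    l zs = refl
cups-+ (suc k) l zs = cong (λ xs → U ∷ D ∷ xs) (cups-+ k l zs)

cup-central : ∀ xs zs → U ∷ D ∷ xs ++ zs ∼ xs ++ U ∷ D ∷ zs
cup-central []       zs = ε
cup-central (x ∷ xs) zs = fwd (slide [] x (xs ++ zs)) ◅ ∷-cong x (cup-central xs zs)

cups-central : ∀ k x zs → x ∷ cups k zs ∼ cups k (x ∷ zs)
cups-central zero    x zs = ε
cups-central (suc k) x zs = bwd (slide [] x (cups k zs)) ◅ ∷-cong U (∷-cong D (cups-central k x zs))

normal : ℕ → ℕ → ℕ → List Letter
normal s k t = replicate s D ++ cups k (replicate t U)

-- Letters are added on the left. A new D joins the initial block. A new U either meets an initial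
-- D, forming a cup that moves past the remaining D's, or, if there is none, passes all cups and
-- joins the final block.
normal-form : ∀ xs → ∃[ s ] ∃[ k ] ∃[ t ] xs ∼ normal s k t
normal-form []       = 0 , 0 , 0 , ε
normal-form (D ∷ xs) with normal-form xs
... | s , k , t , p = suc s , k , t , ∷-cong D p
normal-form (U ∷ xs) with normal-form xs
... | zero  , k , t , p = 0 , k , suc t , ∷-cong U p ◅◅ cups-central k U (replicate t U)
... | suc s , k , t , p = s , suc k , t , ∷-cong U p ◅◅ cup-central (replicate s D) (cups k (replicate t U))

replicate-shift : ∀ {A : Set} s (x : A) xs → replicate s x ++ x ∷ xs ≡ x ∷ replicate s x ++ xs
replicate-shift zero    x xs = refl
replicate-shift (suc s) x xs = cong (x ∷_) (replicate-shift s x xs)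

-- The innermost cup moves out to the front, leaving one nesting level fewer.
nested : ∀ s → replicate s U ++ replicate s D ∼ cups s []
nested zero    = ε
nested (suc s) = subst (_∼ cups (suc s) []) (replicate-shift s U (D ∷ replicate s D))
  (∼-sym (cup-central (replicate s U) (replicate s D)) ◅◅ ∷-cong U (∷-cong D (nested s)))

normal-snoc : ∀ s k t → normal s k (suc t) ≡ normal s k t ++ U ∷ []
normal-snoc s k t = trans (cong (λ xs → replicate s D ++ cups k xs)
    (sym (trans (replicate-shift t U []) (List.++-identityʳ _))))
  (trans (cong (replicate s D ++_) (sym (cups-++ k (replicate t U) (U ∷ []))))
    (sym (List.++-assoc (replicate s D) _ _)))

ups-normal : ∀ s k t → total upWeight (normal s k t) ≡ k + t
ups-normal (suc s) k       t       = ups-normal s k t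
ups-normal zero    (suc k) t       = cong suc (ups-normal zero k t)
ups-normal zero    zero    (suc t) = cong suc (ups-normal zero zero t)
ups-normal zero    zero    zero    = refl

downs-normal : ∀ s k t → total downWeight (normal s k t) ≡ s + k
downs-normal (suc s) k       t       = cong suc (downs-normal s k t)
downs-normal zero    (suc k) t       = cong suc (downs-normal zero k t)
downs-normal zero    zero    (suc t) = downs-normal zero zero t
downs-normal zero    zero    zero    = refl

-- The cups tile the whole word, so a word sharing all their descents agrees with it in every
-- letter.
copy-cups : ∀ k len {f g : ℕ → Letter} → applyUpTo f len ≡ cups k [] →
  (∀ m → suc m ℕ.< len → f m ≡ U → f (suc m) ≡ D → g m ≡ U × g (suc m) ≡ D) → applyUpTo g len ≡ cups k []
copy-cups zero    zero            _  _ = refl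
copy-cups (suc k) (suc zero)      ()
copy-cups (suc k) (suc (suc len)) eq p with p 0 (s≤s (s≤s z≤n)) (List.∷-injectiveˡ eq) (List.∷-injectiveˡ (List.∷-injectiveʳ eq))
... | g₀ , g₁ = cong₂ _∷_ g₀ (cong₂ _∷_ g₁
  (copy-cups k len (List.∷-injectiveʳ (List.∷-injectiveʳ eq)) (λ m m< → p (2 + m) (s≤s (s≤s m<)))))

-- Lifting slides from words to tableaux

module Combinatorics (c : ℕ) where

  open Cycle
  open TwoRows c

  -- The three letters involved have offsets between l and n - 1 from p: the slide leaves the first
  -- l letters alone and does not cross the base point.
  FarCup : Fin n → ℕ → Tab → Tab → Set
  FarCup p l T T′ = ∃[ m ] l ≤ m × 3 + m ≤ n × Cup (at p m) T T′

  Path : Fin n → ℕ → Tab → Tab → Set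
  Path p l = EqClosure (FarCup p l)

  ≤-length-++ : ∀ (xs ys : List Letter) → length xs ≤ length (xs ++ ys)
  ≤-length-++ xs ys = ℕ.≤-trans (ℕ.m≤m+n _ _) (ℕ.≤-reflexive (sym (List.length-++ xs)))

  -- Each elementary slide of the words is realised by a Knuth move of tableaux; its offset is at
  -- least the length of the untouched prefix `xs`.
  walk : ∀ p xs {ys zs} → ys ∼ zs → ∀ T → word p T ≡ xs ++ ys →
    ∃[ T′ ] word p T′ ≡ xs ++ zs × Path p (length xs) T T′
  walk p xs ε T eq = T , eq , ε
  walk p xs (fwd (slide ws z ys) ◅ rest) T eq
    with slideRight-word p T (xs ++ ws) (trans eq (sym (List.++-assoc xs ws _)))
  ... | T₁ , cup , eq₁ with walk p xs rest T₁ (trans eq₁ (List.++-assoc xs ws _))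
  ...   | T′ , eq′ , path = T′ , eq′ , fwd (_ , ≤-length-++ xs ws , slide-fits p T₁ (xs ++ ws) eq₁ , cup) ◅ path
  walk p xs (bwd (slide ws z ys) ◅ rest) T eq
    with slideLeft-word p T (xs ++ ws) (trans eq (sym (List.++-assoc xs ws _)))
  ... | T₁ , cup , eq₁ with walk p xs rest T₁ (trans eq₁ (List.++-assoc xs ws _))
  ...   | T′ , eq′ , path = T′ , eq′ , bwd (_ , ≤-length-++ xs ws , slide-fits p T₁ (xs ++ ws) eq₁ , cup) ◅ path

  rotate-++ : ∀ p T xs {ys} → word p T ≡ xs ++ ys → ∃[ p′ ] word p′ T ≡ ys ++ xs
  rotate-++ p T []       {ys} eq = p , trans eq (sym (List.++-identityʳ ys))
  rotate-++ p T (x ∷ xs) {ys} eq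
    with rotate-++ (next p) T xs (trans (rotate p T eq) (List.++-assoc xs ys _))
  ... | p′ , eq′ = p′ , trans eq′ (List.++-assoc ys _ xs)

  ups≡a : ∀ p T → total upWeight (word p T) ≡ a
  ups≡a p T = trans (total-word upWeight p T)
    (trans (cong₂ _+_ (ℕ.*-identityʳ a) (ℕ.*-zeroʳ a)) (ℕ.+-identityʳ a))

  downs≡a : ∀ p T → total downWeight (word p T) ≡ a
  downs≡a p T = trans (total-word downWeight p T) (cong₂ _+_ (ℕ.*-zeroʳ a) (ℕ.*-identityʳ a))

  Knuth* : Tab → Tab → Set
  Knuth* = EqClosure KnuthMove

  path⇒Knuth* : ∀ {p l T T′} → Path p l T T′ → Knuth* T T′
  path⇒Knuth* = Eq.map (λ (_ , _ , _ , cup) → Cup.knuth cup)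

  -- Counting letters in the normal form gives s = t. Rotating the initial D's to the end leaves k
  -- cups followed by a nested block of s U's and s D's, which `nested` flattens.
  toAlternating : ∀ T → ∃[ T′ ] Knuth* T T′ × ∃[ p ] word p T′ ≡ cups a []
  toAlternating T with normal-form (word Fin.zero T)
  ... | s , k , t , p with walk Fin.zero [] p T refl
  ...   | T₁ , eq₁ , path₁ with rotate-++ Fin.zero T₁ (replicate s D) eq₁
  ...     | p′ , eq′ with walk p′ [] flatten T₁ eq′
    where
    k+t≡a : k + t ≡ a
    k+t≡a = trans (sym (ups-normal s k t)) (trans (cong (total upWeight) (sym eq₁)) (ups≡a Fin.zero T₁))
    s+k≡a : s + k ≡ a
    s+k≡a = trans (sym (downs-normal s k t)) (trans (cong (total downWeight) (sym eq₁)) (downs≡a Fin.zero T₁))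
    k+s≡a : k + s ≡ a
    k+s≡a = trans (ℕ.+-comm k s) s+k≡a
    t≡s : t ≡ s
    t≡s = ℕ.+-cancelˡ-≡ k t s (trans k+t≡a (sym k+s≡a))
    flatten : cups k (replicate t U) ++ replicate s D ∼ cups a []
    flatten = subst₂ _∼_ (sym (trans (cups-++ k (replicate t U) (replicate s D)) (cong (λ t → cups k (replicate t U ++ replicate s D)) t≡s)))
      (trans (cups-+ k s []) (cong (λ k → cups k []) k+s≡a)) (cups-cong k (nested s))
  ...       | T₂ , eq₂ , path₂ = T₂ , path⇒Knuth* path₁ ◅◅ path⇒Knuth* path₂ , p′ , eq₂

  cups-snoc : ∀ k → cups k [] ++ U ∷ D ∷ [] ≡ cups (suc k) []
  cups-snoc k = trans (cups-++ k [] (U ∷ D ∷ [])) (trans (cups-+ k 1 []) (cong (λ k → cups k []) (ℕ.+-comm k 1)))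

  rotate-cups : ∀ p T → word p T ≡ cups a [] → word (next (next p)) T ≡ cups a []
  rotate-cups p T eq = trans (rotate (next p) T (rotate p T eq))
    (trans (List.++-assoc (cups (suc c) []) (U ∷ []) (D ∷ [])) (cups-snoc (suc c)))

  -- The alternating word is unchanged when its base point moves by two, so only the parity of the
  -- distance from p to i matters.
  rebase : ∀ i T m p → at p m ≡ i → word p T ≡ cups a [] → word i T ≡ cups a [] ⊎ word (next i) T ≡ cups a []
  rebase i T zero          p refl eq = inj₁ eq
  rebase i T (suc zero)    p refl eq = inj₂ (rotate-cups p T eq)
  rebase i T (suc (suc m)) p at≡i eq = rebase i T m (next (next p)) at≡i (rotate-cups p T eq)

  toBase : ∀ i T → ∃[ T′ ] Knuth* T T′ × (word i T′ ≡ cups a [] ⊎ word (next i) T′ ≡ cups a [])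
  toBase i T = let T′ , path , p , eq = toAlternating T; m , _ , at≡i = at-surjective p i in
    T′ , path , rebase i T′ m p at≡i eq

  -- Applying `next` another n - 1 times completes the cycle.
  next-injective : ∀ {i j : Fin n} → next i ≡ next j → i ≡ j
  next-injective {i} {j} eq = trans (sym (at-period i)) (trans (cong (λ k → at k (ℕ.pred n)) eq) (at-period j))

  affine-far : ∀ {i j : Fin n} → i ≢ j → j ≢ next i → i ≢ next j → affineS n i j ≡ 2
  affine-far {i} {j} p q r
    rewrite dec-false (i Fin.≟ j) p | dec-false (j Fin.≟ next i) q | dec-false (i Fin.≟ next j) r = refl

  affine-next : ∀ (i : Fin n) → affineS n i (next i) ≡ 3
  affine-next i rewrite dec-false (i Fin.≟ next i) (i≢next i) | dec-true (next i Fin.≟ next i) refl = refl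

  affine-prev : ∀ (i : Fin n) → affineS n (next i) i ≡ 3
  affine-prev i rewrite dec-false (next i Fin.≟ i) (≢-sym (i≢next i)) | dec-true (next i Fin.≟ next i) refl
    | ∨-zeroʳ (does (i Fin.≟ next (next i))) = refl

  -- Excluding j - 1, j, j + 1 and j + 2 does two things at once: i commutes with both j and j + 1,
  -- and a slide at j touches neither letter that decides whether i is a descent.
  record Far (i j : Fin n) : Set where
    field
      ≢₀ : i ≢ j
      ≢₁ : i ≢ next j
      ≢₂ : i ≢ next (next j)
      ≢₋ : next i ≢ j

    affine₀ : affineS n i j ≡ 2
    affine₀ = affine-far ≢₀ (≢-sym ≢₋) ≢₁

    affine₁ : affineS n i (next j) ≡ 2
    affine₁ = affine-far ≢₁ (≢₀ ∘ sym ∘ next-injective) ≢₂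

  far-at : ∀ i {m} → 2 ≤ m → 3 + m ≤ n → Far i (at i m)
  far-at i {m@(suc (suc _))} (s≤s (s≤s z≤n)) f = record
    { ≢₀ = at-≢ i (s≤s z≤n) (ℕ.≤-trans (ℕ.m≤n+m _ 2) f) λ ()
    ; ≢₁ = λ e → at-≢ i (s≤s z≤n) (ℕ.≤-trans (ℕ.m≤n+m _ 1) f) (λ ()) (trans e (next-at i m))
    ; ≢₂ = λ e → at-≢ i (s≤s z≤n) f (λ ()) (trans e (trans (cong next (next-at i m)) (next-at i (suc m))))
    ; ≢₋ = at-≢ i 1<n (ℕ.≤-trans (ℕ.m≤n+m _ 2) f) λ ()
    }

  D⇒∉ : ∀ {T : Tab} {i} → letter T i ≡ D → i ∉ des T
  D⇒∉ {T} {i} eq i∈ = U≢D (trans (sym (proj₁ (des⁻ T i i∈))) eq)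

  nextU⇒∉ : ∀ {T : Tab} {i} → letter T (next i) ≡ U → i ∉ des T
  nextU⇒∉ {T} {i} eq i∈ = U≢D (trans (sym eq) (proj₂ (des⁻ T i i∈)))

  next∈⇒∉ : ∀ {T : Tab} {i} → next i ∈ des T → i ∉ des T
  next∈⇒∉ {T} {i} i∈ = nextU⇒∉ {T} (proj₁ (des⁻ T (next i) i∈))

  module _ {j T T′} (cup : Cup j T T′) where
    open Cup cup

    cup-∈ : j ∈ des T
    cup-∈ = des⁺ T j up down

    cup-∈′ : next j ∈ des T′
    cup-∈′ = des⁺ T′ (next j) up′ down′

    module _ {i} (far : Far i j) where
      open Far far

      letter-far : letter T′ i ≡ letter T i
      letter-far = same ≢₀ ≢₁ ≢₂

      letter-far-next : letter T′ (next i) ≡ letter T (next i)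
      letter-far-next = same ≢₋ (≢₀ ∘ next-injective) (≢₁ ∘ next-injective)

      far-∈ : i ∈ des T → i ∈ des T′
      far-∈ i∈ = let up , down = des⁻ T i i∈ in des⁺ T′ i (trans letter-far up) (trans letter-far-next down)

      far-∈⁻ : i ∈ des T′ → i ∈ des T
      far-∈⁻ i∈ = let up , down = des⁻ T′ i i∈ in des⁺ T i (trans (sym letter-far) up) (trans (sym letter-far-next) down)

  -- Comparing two weight functions that obey the same rules

  record Rules (M : Tab → Tab → ℕ) : Set where
    field
      edge      : ∀ {u v} → KnuthMove u v → M u v ≡ 1
      compat    : ∀ {i j u v} → affineS n i j ≡ 2 → i ∈ des u → j ∉ des u → i ∉ des v → j ∈ des v → M u v ≡ 0
      bond      : ∀ {i j u v w} → affineS n j i ≡ 3 → KnuthMove v w → j ∈ des v → i ∉ des v →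
                  j ∉ des w → i ∈ des w → j ∉ des u → i ∈ des u → u ≢ w → M u v ≡ 0
      slid      : ∀ {i j u u′ v v′} → Far i j → Cup j u u′ → Cup j v v′ → i ∈ des u → i ∉ des v → M u v ≡ M u′ v′

  module Comparison {M M′ : Tab → Tab → ℕ} (R : Rules M) (R′ : Rules M′) where

    private
      module R = Rules R
      module R′ = Rules R′

    -- Fixing the target v and one missing descent i allows v to be moved along slides far from i
    -- while u varies freely.
    Good : Fin n → Tab → Set
    Good i v = ∀ {u : Tab} → i ∈ des u → M u v ≡ 0 ⊎ M u v ≡ M′ u v

    -- If u lacks the descent j of v, compatibility gives 0; otherwise u slides along the same cup
    -- as v, and both weights are preserved.
    good-back : ∀ {i j v v′} → Far i j → Cup j v v′ → i ∉ des v → Good i v′ → Good i v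
    good-back {i} {j} {v} far cup i∉v good {u} i∈u with toSum (j ∈? des u)
    ... | inj₂ j∉u = inj₁ (R.compat (Far.affine₀ far) i∈u j∉u i∉v (cup-∈ cup))
    ... | inj₁ j∈u with slideRight j u (proj₁ (des⁻ u j j∈u)) (proj₂ (des⁻ u j j∈u))
    ...   | u′ , cup′ = subst₂ (λ x y → x ≡ 0 ⊎ x ≡ y)
      (sym (R.slid far cup′ cup i∈u i∉v)) (sym (R′.slid far cup′ cup i∈u i∉v)) (good (far-∈ cup′ far i∈u))

    good-forth : ∀ {i j v v′} → Far i j → Cup j v v′ → i ∉ des v → Good i v → Good i v′
    good-forth {i} {j} {v} far cup i∉v good {u} i∈u with toSum (next j ∈? des u)
    ... | inj₂ j∉u = inj₁ (R.compat (Far.affine₁ far) i∈u j∉u (i∉v ∘ far-∈⁻ cup far) (cup-∈′ cup))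
    ... | inj₁ j∈u with slideLeft j u (proj₁ (des⁻ u (next j) j∈u)) (proj₂ (des⁻ u (next j) j∈u))
    ...   | u′ , cup′ = subst₂ (λ x y → x ≡ 0 ⊎ x ≡ y)
      (R.slid far cup′ cup i∈u′ i∉v) (R′.slid far cup′ cup i∈u′ i∉v) (good i∈u′)
      where i∈u′ = far-∈⁻ cup′ far i∈u

    -- The offset bound 2 protects the letters at i and i + 1, so i stays a non-descent along the
    -- whole path.
    good-path : ∀ {i v v′} → Path i 2 v v′ → i ∉ des v → Good i v′ → Good i v
    good-path ε i∉v good = good
    good-path {i} (fwd (m , l≤m , fits , cup) ◅ path) i∉v good =
      good-back far cup i∉v (good-path path (i∉v ∘ far-∈⁻ cup far) good)
      where far = far-at i l≤m fits
    good-path {i} (bwd (m , l≤m , fits , cup) ◅ path) i∉v good =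
      good-forth far cup i∉v₁ (good-path path i∉v₁ good)
      where
      far = far-at i l≤m fits
      i∉v₁ = i∉v ∘ far-∈ cup far

    -- By the bonding rule the partner w is the only possible source of an arrow into v among the u
    -- with descent i, and there both weights are 1.
    good-bond : ∀ {i j v w} → affineS n j i ≡ 3 → KnuthMove v w → j ∈ des v → i ∉ des v →
      j ∉ des w → i ∈ des w → (∀ {u : Tab} → i ∈ des u → j ∉ des u) → Good i v
    good-bond {v = v} {w} ji knuth j∈v i∉v j∉w i∈w disj {u} i∈u with u ≟ᵀ w
    ... | yes refl = inj₂ (trans (R.edge (knuthMove-sym {T = v} {u} knuth)) (sym (R′.edge (knuthMove-sym {T = v} {u} knuth))))
    ... | no  u≢w  = inj₁ (R.bond {v = v} {w} ji knuth j∈v i∉v j∉w i∈w (disj {u} i∈u) i∈u u≢w)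

    Connected : Set
    Connected = ∀ u v → EqClosure (λ u v → M u v ≢ 0) u v

    knuth⇒connected : ∀ {u v} → Knuth* u v → EqClosure (λ u v → M u v ≢ 0) u v
    knuth⇒connected = Eq.map (λ knuth M≡0 → contradiction (trans (sym (R.edge knuth)) M≡0) λ ())

    -- Disconnectedness enters here: a nonzero `M u v` would link the two alternating tableaux based
    -- at i and at i + 1, to one of which every tableau is joined.
    good-wrap : ¬ Connected → ∀ {i v k} → suc k ≡ a → word i v ≡ D ∷ U ∷ cups k [] → Good i v
    good-wrap ¬connected {i} {v} {k} k+1≡a eq {u} i∈u with M u v ℕ.≟ 0
    ... | yes M≡0 = inj₁ M≡0
    ... | no  M≢0 = contradiction connected ¬connected
      where
      i∉v : i ∉ des v
      i∉v = D⇒∉ {v} (at-read i v [] eq)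

      -- A descent j of v beyond the first two letters is not adjacent to i on the cycle, so
      -- compatibility and `M≢0` force it to be a descent of u as well.
      kept : ∀ m → suc m ℕ.< _ → reading i v (2 + m) ≡ U → reading i v (3 + m) ≡ D →
        reading i u (2 + m) ≡ U × reading i u (3 + m) ≡ D
      kept m m< up down = let up′ , down′ = des⁻ u j j∈u in up′ , trans (cong (letter u) (sym (next-at i (2 + m)))) down′
        where
        j = at i (2 + m)
        j∈v : j ∈ des v
        j∈v = des⁺ v j up (trans (cong (letter v) (next-at i (2 + m))) down)
        3+m<n : 3 + m ℕ.< n
        3+m<n = s≤s (s≤s m<)
        far : affineS n i j ≡ 2
        far = affine-far (at-≢ i (s≤s z≤n) (ℕ.<⇒≤ 3+m<n) λ ())
          (at-≢ i (ℕ.<⇒≤ 3+m<n) 1<n λ ())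
          (λ e → at-≢ i (s≤s z≤n) 3+m<n (λ ()) (trans e (next-at i (2 + m))))
        j∈u : j ∈ des u
        j∈u with toSum (j ∈? des u)
        ... | inj₁ j∈u = j∈u
        ... | inj₂ j∉u = contradiction (R.compat far i∈u j∉u i∉v j∈v) M≢0

      word-u : word i u ≡ cups a []
      word-u = trans (cong₂ _∷_ (proj₁ (des⁻ u i i∈u)) (cong₂ _∷_ (proj₂ (des⁻ u i i∈u))
          (copy-cups k _ {f = λ m → reading i v (2 + m)} (List.∷-injectiveʳ (List.∷-injectiveʳ eq)) kept)))
        (cong (λ k → cups k []) k+1≡a)

      -- Read from i + 1, v is a U, then k cups, then a D; the U passes the cups and forms the last
      -- cup with the D.
      flatten : U ∷ cups k [] ++ D ∷ [] ∼ cups a []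
      flatten = subst₂ _∼_ (cong (U ∷_) (sym (cups-++ k [] (D ∷ []))))
        (trans (cups-+ k 1 []) (cong (λ k → cups k []) (trans (ℕ.+-comm k 1) k+1≡a))) (cups-central k U (D ∷ []))

      v′ : ∃[ v′ ] word (next i) v′ ≡ cups a [] × Path (next i) 0 v v′
      v′ = walk (next i) [] flatten v (rotate i v eq)

      u~ : Tab → Set
      u~ T = EqClosure (λ u v → M u v ≢ 0) T u

      v′~u : u~ (proj₁ v′)
      v′~u = Eq.symmetric _ (fwd M≢0 ◅ knuth⇒connected (path⇒Knuth* (proj₂ (proj₂ v′))))

      -- Words determine tableaux: the alternating word read from i belongs to u, and read from i +
      -- 1 to the tableau reached from v.
      base~ : ∀ T → word i T ≡ cups a [] ⊎ word (next i) T ≡ cups a [] → u~ T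
      base~ T (inj₁ eq′) = subst u~ (word-injective i (trans word-u (sym eq′))) ε
      base~ T (inj₂ eq′) = subst u~ (word-injective (next i) (trans (proj₁ (proj₂ v′)) (sym eq′))) v′~u

      toU : ∀ T → u~ T
      toU T = let T′ , path , base = toBase i T in knuth⇒connected path ◅◅ base~ T′ base

      connected : Connected
      connected S T = toU S ◅◅ Eq.symmetric _ (toU T)

    good-normal : ¬ Connected → ∀ {i v} → i ∉ des v → ∀ x y s k t → word i v ≡ x ∷ y ∷ normal s k t → Good i v
    good-normal ¬connected {i} {v} i∉v x y s k t eq = cases x y s t eq
      (trans (sym (cong (λ m → upWeight x + (upWeight y + m)) (ups-normal s k t))) (trans (cong (total upWeight) (sym eq)) (ups≡a i v)))
      (trans (sym (cong (λ m → downWeight x + (downWeight y + m)) (downs-normal s k t))) (trans (cong (total downWeight) (sym eq)) (downs≡a i v)))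
      where
      -- The cup at i + 1 slides left onto i, which supplies the bonded partner.
      right : ∀ {x zs} → word i v ≡ x ∷ U ∷ D ∷ zs → Good i v
      right {x} eq with slideLeft-word i v [] eq
      ... | w , cup , _ = good-bond {v = v} {w} (affine-prev i) (knuthMove-sym {T = w} {v} (Cup.knuth cup)) (cup-∈′ cup) i∉v
        (D⇒∉ {w} (Cup.down cup)) (cup-∈ cup) (λ {u} i∈u i+1∈u → next∈⇒∉ {u} i+1∈u i∈u)

      next-last : ∀ xs → word i v ≡ (D ∷ xs) ++ U ∷ [] → next (at i (suc (length xs))) ≡ i
      next-last xs eq = trans (next-at i (suc (length xs)))
        (trans (cong (at i) (trans (ℕ.+-comm 1 (suc (length xs))) (window i v (D ∷ xs) eq))) (at-period i))

      -- The last letter U and the first letter D form a cup across the base point, at i - 1;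
      -- sliding it right onto i supplies the bonded partner.
      left : ∀ xs → word i v ≡ (D ∷ xs) ++ U ∷ [] → Good i v
      left xs eq with slideRight (at i (suc (length xs))) v (at-read i v (D ∷ xs) eq)
        (trans (cong (letter v) (next-last xs eq)) (at-read i v [] eq))
      ... | w , cup = good-bond {v = v} {w} (subst (λ k → affineS n j k ≡ 3) next-j (affine-next j)) (Cup.knuth cup) (cup-∈ cup) i∉v
        (nextU⇒∉ {w} (Cup.up′ cup)) (subst (_∈ des w) next-j (cup-∈′ cup))
        (λ {u} i∈u → next∈⇒∉ {u} (subst (_∈ des u) (sym next-j) i∈u))
        where
        j = at i (suc (length xs))
        next-j = next-last xs eq

      -- The equal counts of U and D exclude `U U` with s = 0 and `D D` with t = 0, and they force t
      -- = 0 for `D U` with s = 0.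
      cases : ∀ x y s t → word i v ≡ x ∷ y ∷ normal s k t →
        upWeight x + (upWeight y + (k + t)) ≡ a → downWeight x + (downWeight y + (s + k)) ≡ a → Good i v
      cases U D s t eq _ _ = contradiction (des⁺ v i (at-read i v [] eq) (List.∷-injectiveˡ (List.∷-injectiveʳ eq))) i∉v
      cases x U (suc s) t eq _ _ = right eq
      cases U U zero t eq ups downs = contradiction (trans ups (sym downs)) (ℕ.<⇒≢ (ℕ.≤-trans (s≤s (ℕ.m≤m+n k t)) (ℕ.n≤1+n _)) ∘ sym)
      cases D U zero t eq ups downs = good-wrap ¬connected downs
        (trans eq (cong (λ t → D ∷ U ∷ cups k (replicate t U)) (ℕ.+-cancelˡ-≡ (suc k) t 0 (trans ups (trans (sym downs) (sym (ℕ.+-identityʳ _)))))))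
      cases D D s (suc t) eq _ _ = left (D ∷ normal s k t) (trans eq (cong (λ xs → D ∷ D ∷ xs) (normal-snoc s k t)))
      cases D D s zero eq ups downs = contradiction (trans (sym (ℕ.+-identityʳ k)) (trans ups (sym downs)))
        (ℕ.<⇒≢ (ℕ.≤-trans (s≤s (ℕ.m≤n+m k s)) (ℕ.n≤1+n _)))

    good : ¬ Connected → ∀ {i v} → i ∉ des v → Good i v
    good ¬connected {i} {v} i∉v with normal-form (applyUpTo (λ m → reading i v (2 + m)) _)
    ... | s , k , t , p with walk i (letter v i ∷ letter v (next i) ∷ []) p v refl
    ...   | v′ , eq , path = good-path path i∉v (good-normal ¬connected i∉v′ _ _ s k t eq)
      where
      i∉v′ : i ∉ des v′
      i∉v′ i∈ = i∉v (des⁺ v i (trans (sym (List.∷-injectiveˡ eq)) (proj₁ (des⁻ v′ i i∈)))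
        (trans (sym (List.∷-injectiveˡ (List.∷-injectiveʳ eq))) (proj₂ (des⁻ v′ i i∈))))

-- Passing from labelled graphs to tableaux

≅-trans : ∀ {n} {Γ Δ Θ : LabeledGraph n} → Γ ≅ Δ → Δ ≅ Θ → Γ ≅ Θ
≅-trans p q = record
  { bijection = q.bijection ↔-∘ p.bijection
  ; m-pres    = λ u v → ≈-trans (q.m-pres (p.to u) (p.to v)) (p.m-pres u v)
  ; τ-pres    = λ u → trans (q.τ-pres (p.to u)) (p.τ-pres u)
  }
  where
  module p = _≅_ p
  module q = _≅_ q

≅-refl : ∀ {n} {Γ : LabeledGraph n} → Γ ≅ Γ
≅-refl = record { bijection = ↔-id _ ; m-pres = λ _ _ → ≈-refl ; τ-pres = λ _ → refl }

fromℕᴸ-0 : fromℕᴸ 0 ≈ᴸ 0ᴸ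
fromℕᴸ-0 = mk≈ᴸ zero-coeff
  where
  zero-coeff : ∀ k → coeffᴸ (fromℕᴸ 0) k ≡ + 0
  zero-coeff k with does (+ 0 ℤ.≟ k)
  ... | true  = refl
  ... | false = refl

⊈⇒∃ : ∀ {n} {p q : Subset n} → ¬ (∃[ i ] i ∈ p × i ∉ q) → p ⊆ q
⊈⇒∃ {q = q} none {i} i∈p = decidable-stable (i ∈? q) (λ i∉q → none (i , i∈p , i∉q))

module Tableaux (c : ℕ) {Γ : LabeledGraph (TwoRows.n c)} (W : IsWGraph (affineS (TwoRows.n c)) Γ)
  (nb : NbAdmissible Γ) (iso : simpleUnderlying Γ ≅ 𝒟 (TwoRows.μ c)) where

  open TwoRows c
  open Combinatorics c
  open LabeledGraph Γ
  open _≅_ iso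

  to-from : ∀ T → to (from T) ≡ T
  to-from = Inverse.strictlyInverseˡ bijection

  from-to : ∀ v → from (to v) ≡ v
  from-to = Inverse.strictlyInverseʳ bijection

  tableauWeight : Tab → Tab → ℕ
  tableauWeight T T′ = weight W nb (from T) (from T′)

  τ-from : ∀ T → τ (from T) ≡ des T
  τ-from T = trans (sym (τ-pres (from T))) (cong des (to-from T))

  ∈-from : ∀ {i T} → i ∈ des T → i ∈ τ (from T)
  ∈-from {i} {T} = subst (i ∈_) (sym (τ-from T))

  ∉-from : ∀ {i T} → i ∉ des T → i ∉ τ (from T)
  ∉-from {i} {T} i∉ = i∉ ∘ subst (i ∈_) (τ-from T)

  -- The isomorphism makes the entry of the simple underlying graph equal to 1, hence nonzero, which
  -- by definition happens only if both weights are 1.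
  knuth-edge : ∀ {T T′} → KnuthMove T T′ → SimpleEdge W nb (from T) (from T′)
  knuth-edge {T} {T′} knuth = weight-unique W nb (proj₁ both) , weight-unique W nb (proj₂ both)
    where
    u = from T
    v = from T′
    knuth′ : KnuthMove (to u) (to v)
    knuth′ = subst₂ KnuthMove (sym (to-from T)) (sym (to-from T′)) knuth
    one : LabeledGraph.m (𝒟 μ) (to u) (to v) ≈ᴸ 1ᴸ
    one rewrite dec-true (knuthMove? (to u) (to v)) knuth′ = ≈-refl
    both : m u v ≈ᴸ 1ᴸ × m v u ≈ᴸ 1ᴸ
    both = indicator≉0 ((m u v ≈ᴸ? 1ᴸ) ×-dec (m v u ≈ᴸ? 1ᴸ))
      (λ z → 1≉0 (≈-trans (≈-sym one) (≈-trans (m-pres u v) z)))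

  rules : Rules tableauWeight
  rules = record
    { edge = λ {u} {v} knuth → proj₁ (knuth-edge {u} {v} knuth)
    ; compat = λ {i} {j} {u} {v} ij i∈u j∉u i∉v j∈v →
        compatibility W nb ij (∈-from {i} {u} i∈u) (∉-from {j} {u} j∉u) (∉-from {i} {v} i∉v) (∈-from {j} {v} j∈v)
    ; bond = λ {i} {j} {u} {v} {w} ji knuth j∈v i∉v j∉w i∈w j∉u i∈u u≢w → proj₂
        (bonding W nb ji (∈-from {j} {v} j∈v) (∉-from {i} {v} i∉v) (∉-from {j} {w} j∉w) (∈-from {i} {w} i∈w)
          (∉-from {j} {u} j∉u) (∈-from {i} {u} i∈u) (knuth-edge {v} {w} knuth)
          (λ eq → u≢w (trans (sym (to-from u)) (trans (cong to eq) (to-from w)))))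
    ; slid = λ {i} {j} {u} {u′} {v} {v′} far cup cup′ i∈u i∉v →
        transport W nb (Far.affine₀ far) (Far.affine₁ far) (affine-next j) (affine-prev j)
          (λ {w} j′∈ j∈ → next∈⇒∉ {to w} (subst (next j ∈_) (sym (τ-pres w)) j′∈) (subst (j ∈_) (sym (τ-pres w)) j∈))
          (∈-from {i} {u} i∈u) (∈-from {i} {u′} (far-∈ cup far i∈u))
          (∉-from {i} {v} i∉v) (∉-from {i} {v′} (i∉v ∘ far-∈⁻ cup′ far))
          (∈-from {j} {u} (cup-∈ cup)) (∈-from {next j} {u′} (cup-∈′ cup))
          (∈-from {j} {v} (cup-∈ cup′)) (∈-from {next j} {v′} (cup-∈′ cup′))
          (knuth-edge {u} {u′} (Cup.knuth cup)) (knuth-edge {v} {v′} (Cup.knuth cup′))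
    }

theorem9p6 : (a : ℕ) → 3 ≤ 2 * a → (Γ Γ′ : LabeledGraph (2 * a)) →
    IsWGraph (affineS (2 * a)) Γ → Reduced Γ → NbAdmissible Γ →
    IsWGraph (affineS (2 * a)) Γ′ → Reduced Γ′ → NbAdmissible Γ′ →
    simpleUnderlying Γ ≅ simpleUnderlying Γ′ → simpleUnderlying Γ′ ≅ 𝒟 (a ∷ a ∷ []) →
    LabeledGraph.Disconnected Γ → Embedding Γ Γ′
theorem9p6 zero          ()
theorem9p6 (suc zero)    (s≤s (s≤s ()))
-- Each weight of Γ is 0 or the corresponding weight of Γ′, so Γ itself serves as the subgraph,
-- included by the isomorphism `φ` of the simple underlying graphs.
theorem9p6 (suc (suc c)) _ Γ Γ′ W reduced nb W′ _ nb′ φ iso′ disconnected = Γ , subgraph , ≅-refl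
  where
  open TwoRows c
  open Combinatorics c
  module Γ  = LabeledGraph Γ
  module Γ′ = LabeledGraph Γ′
  module φ  = _≅_ φ
  module T  = Tableaux c W nb (≅-trans φ iso′)
  module T′ = Tableaux c W′ nb′ iso′
  open Comparison T.rules T′.rules using (Connected; good)

  toTab : Γ.V → Tab
  toTab = _≅_.to (≅-trans φ iso′)

  ¬connected : ¬ Connected
  ¬connected connected = disconnected λ u v → subst₂ (EqClosure Γ.Edge) (T.from-to u) (T.from-to v)
    (Eq.gmap _ (λ M≢0 m≈0 → M≢0 (≈0⇒weight≡0 W nb m≈0)) (connected (toTab u) (toTab v)))

  compare : ∀ u v → weight W nb u v ≡ 0 ⊎ weight W nb u v ≡ weight W′ nb′ (φ.to u) (φ.to v) → 
    Γ.m u v ≈ᴸ Γ′.m (φ.to u) (φ.to v) ⊎ Γ.m u v ≈ᴸ 0ᴸ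
  compare u v (inj₁ w≡0)  = inj₂ (≈-trans (weight-≈ W nb u v) (≈-trans (≈-reflexive (cong fromℕᴸ w≡0)) fromℕᴸ-0))
  compare u v (inj₂ w≡w′) = inj₁ (≈-trans (weight-≈ W nb u v) (≈-trans (≈-reflexive (cong fromℕᴸ w≡w′))
    (≈-sym (weight-≈ W′ nb′ (φ.to u) (φ.to v)))))

  m-sub : ∀ u v → Γ.m u v ≈ᴸ Γ′.m (φ.to u) (φ.to v) ⊎ Γ.m u v ≈ᴸ 0ᴸ
  m-sub u v with Fin.any? (λ i → (i ∈? Γ.τ u) ×-dec ¬? (i ∈? Γ.τ v))
  -- If no i separates the labels, then τ(u) ⊆ τ(v) and reducedness gives 0; otherwise such an i
  -- feeds the comparison of weights.
  ... | no  none = inj₂ (reduced u v (⊈⇒∃ none))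
  ... | yes (i , i∈u , i∉v) = compare u v (subst₂ (λ x y → x ≡ 0 ⊎ x ≡ y)
    (cong₂ (weight W nb) (T.from-to u) (T.from-to v))
    (cong₂ (weight W′ nb′) (T′.from-to (φ.to u)) (T′.from-to (φ.to v)))
    (good ¬connected {i} {toTab v} (i∉v ∘ subst (i ∈_) (_≅_.τ-pres (≅-trans φ iso′) v))
      (subst (i ∈_) (sym (_≅_.τ-pres (≅-trans φ iso′) u)) i∈u)))

  subgraph : IsSubgraph Γ Γ′
  subgraph = record
    { incl     = φ.to
    ; incl-inj = λ {u} {v} eq → trans (sym (Inverse.strictlyInverseʳ φ.bijection u))
        (trans (cong φ.from eq) (Inverse.strictlyInverseʳ φ.bijection v))
    ; m-sub    = m-sub
    ; τ-sub    = λ u → sym (φ.τ-pres u)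
    }
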